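{- Let $r$ and $s$ be integers with $2\le s\le r$, and let $\ell$ be the smallest positive integer such that $\lceil r\cdot 2^{ -\ell}\rceil<s$. Then $$\mathbf{RT}_r(n,K_{r+s},o(n))\ge 2^{ -\ell-2}n^2+o(n^2),$$ that is, $\theta_r(K_{r+s})\ge 2^{ -\ell-2}$.
   Context: For a graph $G$, the $K_r$-independence number is $\alpha_r(G)=\max\{|S|: S\subseteq V(G),\ G[S]\text{ is }K_r\text{ -free}\}$. For a graph $H$ and a function $f$, $\mathbf{RT}_r(n,H,f(n))$ denotes the maximum number of edges in an $H$-free graph $G$ on $n$ vertices with $\alpha_r(G)\le f(n)$. The $r$-Ramsey–Turán number of $H$ is $\theta_r(H)=\lim_{\epsilon\to 0}\lim_{n\to\infty}\frac{1}{n^2}\mathbf{RT}_r(n,H,\epsilon n)$ (this limit exists when $H$ is a complete graph), and one writes $\mathbf{RT}_r(n,H,o(n))=\theta_r(H)n^2+o(n^2)$. $K_t$ denotes the complete graph on $t$ vertices. -}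

module Defs where

open import Data.Nat using (ℕ; zero; suc; _+_; _*_; _∸_; _^_; _≤_; _<_; _<ᵇ_)
open import Data.Nat.DivMod using (_/_)
open import Data.Nat.Properties using (m^n≢0)
open import Data.Bool using (Bool; true; false; if_then_else_; _∧_)
open import Data.Fin using (Fin; toℕ)
open import Data.Fin.Subset using (Subset; _∈_; ∣_∣)
open import Data.List using (List; map; allFin; cartesianProduct)
open import Data.Nat.ListAction using (sum)
open import Data.Product using (Σ; ∃; _×_; _,_)
open import Function.Definitions using (Injective)
open import Relation.Binary.PropositionalEquality using (_≡_; _≢_)
open import Relation.Nullary using (¬_)

ceilDivPow2 : ℕ → ℕ → ℕ
ceilDivPow2 a l = _/_ (a + (2 ^ l ∸ 1)) (2 ^ l) {{m^n≢0 2 l}}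

IsLeastEll : ℕ → ℕ → ℕ → Set
IsLeastEll r s l =
  (1 ≤ l) × (ceilDivPow2 r l < s) × (∀ j → 1 ≤ j → j < l → ¬ (ceilDivPow2 r j < s))

record Graph (n : ℕ) : Set where
  field
    adj    : Fin n → Fin n → Bool
    sym    : ∀ i j → adj i j ≡ adj j i
    irrefl : ∀ i → adj i i ≡ false
open Graph public

edgeCount : ∀ {n} → Graph n → ℕ
edgeCount {n} G =
  sum (map (λ p → count (Data.Product.proj₁ p) (Data.Product.proj₂ p))
           (cartesianProduct (allFin n) (allFin n)))
  where
  count : Fin n → Fin n → ℕ
  count i j = if (toℕ i <ᵇ toℕ j) ∧ adj G i j then 1 else 0

HasCliqueIn : ∀ {n} → ℕ → Graph n → Subset n → Set
HasCliqueIn {n} t G S =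
  Σ (Fin t → Fin n) λ f →
    Injective _≡_ _≡_ f × (∀ a → f a ∈ S) × (∀ a b → a ≢ b → adj G (f a) (f b) ≡ true)

CliqueFree : ∀ {n} → ℕ → Graph n → Set
CliqueFree {n} t G =
  ¬ (Σ (Fin t → Fin n) λ f →
       Injective _≡_ _≡_ f × (∀ a b → a ≢ b → adj G (f a) (f b) ≡ true))

-- α_r(G) ≤ bound : every S with G[S] K_r-free has |S| ≤ bound
-- (stated with bound = n / (k+1) cleared of denominators: |S|·(k+1) ≤ n)
AlphaAtMostFrac : ∀ {n} → ℕ → Graph n → ℕ → Set
AlphaAtMostFrac {n} r G k = ∀ (S : Subset n) → ¬ HasCliqueIn r G S → ∣ S ∣ * suc k ≤ n

{-# OPTIONS --safe #-}

-- A Bollobás–Erdős graph on Hamming space. Fix a colouring σ of the roles 1, …, r by bit vectors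
-- of length l in which every colour has at most q = ⌈r/2^l⌉ < s roles. A role j acts on words over
-- a finite alphabet letter by letter, flipping the colour bits by σ j. By the isoperimetric
-- inequality, a dense set of words contains g_1 x + errors, …, g_r x + errors for a single word x,
-- with few errors; joining such words inside either half of the vertex set makes α_r small. The
-- alphabet is chosen so that a clique inside one half has well-defined distinct roles.
--
-- Across the halves, words are joined when for each of the l colour bits they agree in slightly
-- more than half of the places, which has probability about 2^(-l). If both halves of a clique
-- contain roles j and j′ whose colours differ in some bit, that bit is nearly complemented in both
-- halves, so the four comparisons agree in half of the places on average, a contradiction. Hence
-- the roles present in both halves have a single colour, there are at most q of them, and a clique
-- has at most r + q < r + s vertices.
--
-- In Hamming space the errors are as large as the typical deviation from one half. This is
-- compensated by comparing the letters at the endpoints of the edges of a bipartite graph of large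
-- constant degree in which small sets of positions span few edges.
module Submission where

open import Defs hiding (sym)
open import Data.Nat using (ℕ; zero; suc; _+_; _*_; _∸_; _^_; _≤_; _<_; z≤n; s≤s; NonZero; _≤?_; >-nonZero; >-nonZero⁻¹; _≡ᵇ_; _<ᵇ_)
open import Data.Product using (Σ; ∃; ∃₂; ∃-syntax; _×_; _,_; proj₁; proj₂)
open import Data.Bool using (Bool; true; false; if_then_else_; _xor_; not; _∧_; _∨_; T)
import Data.Bool.Properties as Bool
open import Data.Empty using (⊥)
open import Data.Fin using (Fin; zero; suc; toℕ; fromℕ<; splitAt; join; inject≤; remQuot; combine; finToFun; funToFin) renaming (_<_ to _<ᶠ_)
import Data.Fin.Properties as Fin
open import Data.Fin.Subset using (Subset; ∣_∣)
open import Data.List using (List; []; _∷_; map; length; allFin; cartesianProduct; cartesianProductWith; _++_)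
import Data.List as List
open import Data.List.Properties using (length-tabulate; map-tabulate)
open import Data.List.Membership.Propositional using (_∈_; lose)
open import Data.List.Membership.Propositional.Properties using (∈-cartesianProductWith⁺; ∈-cartesianProduct⁺; ∈-allFin)
open import Data.List.Relation.Unary.Any using (Any; here; there; any?; satisfied)
open import Data.Nat.DivMod using (_/_; _%_; m≡m%n+[m/n]*n; m%n<n)
open import Data.Nat.ListAction using (sum)
open import Data.Nat.Properties hiding (_≟_; _≤?_)
open import Data.Nat.Tactic.RingSolver using (solve-∀)
import Data.Product.Properties as Product
open import Data.Sum using (_⊎_; inj₁; inj₂)
open import Data.Sum.Properties using (inj₁-injective; inj₂-injective)
open import Data.Vec as Vec using (Vec; []; _∷_; lookup; zipWith)
import Data.Vec.Properties as Vec
open import Function using (_∘_; id)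
open import Function.Bundles using (mk⇔)
open import Relation.Binary.Definitions using (DecidableEquality; tri<; tri≈; tri>)
open import Relation.Binary.PropositionalEquality using (_≡_; _≢_; refl; sym; trans; cong; cong₂; subst; module ≡-Reasoning)
open import Relation.Nullary using (¬_; Dec; yes; no; contradiction; does; _×-dec_; ¬?)
open import Relation.Nullary.Decidable using (decidable-stable; dec-true; dec-false; does-⇔)

-- The scale is a parameter `z`: words of symbols have `z²` letters, so concentration gives errors
-- of order `z`. A place of a comparison is lost only if both endpoints of its edge are errors
-- (`parity`), so the loss is the number of edges spanned by two sets of `2Cz` positions. The choice
-- of `E` keeps this below `(8C + 1)z` for any fixed average degree, once `z` is large. The number
-- of places grows with the degree and their standard deviation with its root, so a large degree
-- makes the margin `a` negligible and a comparison is light with probability close to 1/2.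
--
-- Nothing is known about how `E` treats two given words, so each vertex carries further bit words
-- `u` that flip the comparisons: over `u` alone, comparisons are exactly uniform and independent.
-- Demanding equal `u` inside a half keeps the four-comparison argument intact and does not hurt the
-- independence number, since a dense set is dense for some `u`.
--
-- The limits are explicit: the independence number is at most `n/(k + 1)`, the edges number at
-- least `(2^(-l-2) - 1/(m + 1)) n²`, and denominators are cleared.

private variable
  A B C : Set

-- Finite sums and elementary inequalities

∑ : List A → (A → ℕ) → ℕ
∑ []       f = 0
∑ (x ∷ xs) f = f x + ∑ xs f

∑≡sum : ∀ (xs : List A) (f : A → ℕ) → ∑ xs f ≡ sum (map f xs)
∑≡sum []       f = refl
∑≡sum (x ∷ xs) f = cong (f x +_) (∑≡sum xs f)

∑-mono : ∀ (xs : List A) {f g : A → ℕ} → (∀ x → f x ≤ g x) → ∑ xs f ≤ ∑ xs g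
∑-mono []       f≤g = z≤n
∑-mono (x ∷ xs) f≤g = +-mono-≤ (f≤g x) (∑-mono xs f≤g)

∑-cong : ∀ (xs : List A) {f g : A → ℕ} → (∀ x → f x ≡ g x) → ∑ xs f ≡ ∑ xs g
∑-cong []       f≡g = refl
∑-cong (x ∷ xs) f≡g = cong₂ _+_ (f≡g x) (∑-cong xs f≡g)

∑-const : ∀ (xs : List A) c → ∑ xs (λ _ → c) ≡ length xs * c
∑-const []       c = refl
∑-const (x ∷ xs) c = cong (c +_) (∑-const xs c)

∑-+ : ∀ (xs : List A) (f g : A → ℕ) → ∑ xs (λ x → f x + g x) ≡ ∑ xs f + ∑ xs g
∑-+ []       f g = refl
∑-+ (x ∷ xs) f g rewrite ∑-+ xs f g = interchange (f x) (g x) (∑ xs f) (∑ xs g)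
  where
  interchange : ∀ a b c d → a + b + (c + d) ≡ a + c + (b + d)
  interchange = solve-∀

∑-*ˡ : ∀ (xs : List A) c (f : A → ℕ) → ∑ xs (λ x → c * f x) ≡ c * ∑ xs f
∑-*ˡ []       c f = sym (*-zeroʳ c)
∑-*ˡ (x ∷ xs) c f rewrite ∑-*ˡ xs c f = sym (*-distribˡ-+ c (f x) (∑ xs f))

∑-*ʳ : ∀ (xs : List A) c (f : A → ℕ) → ∑ xs (λ x → f x * c) ≡ ∑ xs f * c
∑-*ʳ []       c f = refl
∑-*ʳ (x ∷ xs) c f rewrite ∑-*ʳ xs c f = sym (*-distribʳ-+ c (f x) (∑ xs f))

∑-swap : ∀ (xs : List A) (ys : List B) (f : A → B → ℕ) →
         ∑ xs (λ x → ∑ ys (f x)) ≡ ∑ ys (λ y → ∑ xs (λ x → f x y))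
∑-swap []       ys f = sym (trans (∑-const ys 0) (*-zeroʳ (length ys)))
∑-swap (x ∷ xs) ys f = trans (cong (∑ ys (f x) +_) (∑-swap xs ys f))
                             (sym (∑-+ ys (f x) (λ y → ∑ xs (λ x′ → f x′ y))))

∑-++ : ∀ (xs ys : List A) (f : A → ℕ) → ∑ (xs ++ ys) f ≡ ∑ xs f + ∑ ys f
∑-++ []       ys f = refl
∑-++ (x ∷ xs) ys f = trans (cong (f x +_) (∑-++ xs ys f)) (sym (+-assoc (f x) _ _))

∑-map : ∀ (g : A → B) (xs : List A) (f : B → ℕ) → ∑ (map g xs) f ≡ ∑ xs (f ∘ g)
∑-map g []       f = refl
∑-map g (x ∷ xs) f = cong (f (g x) +_) (∑-map g xs f)

∑-cartesianProductWith : ∀ (h : A → B → C) (xs : List A) (ys : List B) (f : C → ℕ) →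
  ∑ (cartesianProductWith h xs ys) f ≡ ∑ xs (λ x → ∑ ys (λ y → f (h x y)))
∑-cartesianProductWith h []       ys f = refl
∑-cartesianProductWith h (x ∷ xs) ys f =
  trans (∑-++ (map (h x) ys) _ f)
        (cong₂ _+_ (∑-map (h x) ys f) (∑-cartesianProductWith h xs ys f))

∑-allFin-suc : ∀ n (f : Fin (suc n) → ℕ) → ∑ (allFin (suc n)) f ≡ f zero + ∑ (allFin n) (f ∘ suc)
∑-allFin-suc n f = cong (f zero +_)
  (trans (cong (λ l → ∑ l f) (sym (map-tabulate id suc))) (∑-map suc (allFin n) f))

∑-length : ∀ (xs : List A) → ∑ xs (λ _ → 1) ≡ length xs
∑-length xs = trans (∑-const xs 1) (*-identityʳ (length xs))

∑-<⇒∃ : ∀ (xs : List A) {f g : A → ℕ} → ∑ xs f < ∑ xs g → ∃ λ x → f x < g x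
∑-<⇒∃ (x ∷ xs) {f} {g} lt with f x <? g x
... | yes fx<gx = x , fx<gx
... | no  fx≮gx = ∑-<⇒∃ xs (≰⇒> λ gs≤fs → <⇒≱ lt (+-mono-≤ (≮⇒≥ fx≮gx) gs≤fs))

∑-<length⇒∃≡0 : ∀ (xs : List A) {f : A → ℕ} → ∑ xs f < length xs → ∃ λ x → f x ≡ 0
∑-<length⇒∃≡0 xs {f} lt with ∑-<⇒∃ xs {f} {λ _ → 1} (subst (∑ xs f <_) (sym (∑-length xs)) lt)
... | x , fx<1 = x , n<1⇒n≡0 fx<1

∑≡0⇒≡0-Fin : ∀ {n} (f : Fin n → ℕ) → ∑ (allFin n) f ≡ 0 → ∀ i → f i ≡ 0
∑≡0⇒≡0-Fin {suc n} f eq zero = m+n≡0⇒m≡0 (f zero) eq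
∑≡0⇒≡0-Fin {suc n} f eq (suc i) =
  ∑≡0⇒≡0-Fin (f ∘ suc) (m+n≡0⇒n≡0 (f zero) (trans (sym (∑-allFin-suc n f)) eq)) i

≤∑-∈ : ∀ {xs : List A} {x} (f : A → ℕ) → x ∈ xs → f x ≤ ∑ xs f
≤∑-∈ f (here refl) = m≤m+n (f _) _
≤∑-∈ f (there x∈)  = ≤-trans (≤∑-∈ f x∈) (m≤n+m _ (f _))

⟦_⟧ : Bool → ℕ
⟦ b ⟧ = if b then 1 else 0

⟦⟧≤1 : ∀ b → ⟦ b ⟧ ≤ 1
⟦⟧≤1 true  = s≤s z≤n
⟦⟧≤1 false = z≤n

-- Bernoulli's inequality `(1 − x)^y ≥ 1 − yx` for `x = K/(Q + K)`, with denominators cleared.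
bernoulli : ∀ Q K y → (Q + K) ^ y * (Q + K) ≤ Q ^ y * (Q + K) + y * K * (Q + K) ^ y
bernoulli Q K zero    = m≤m+n _ _
bernoulli Q K (suc y) = begin
  (Q + K) * p * (Q + K)                          ≡⟨ e₁ Q K p ⟩
  Q * (p * (Q + K)) + K * ((Q + K) * p)          ≤⟨ +-monoˡ-≤ _ (*-monoʳ-≤ Q (bernoulli Q K y)) ⟩
  Q * (q * (Q + K) + y * K * p) + K * ((Q + K) * p)
                                                 ≤⟨ +-monoˡ-≤ (K * ((Q + K) * p)) (e₂ Q K p q y) ⟩
  Q * q * (Q + K) + y * K * ((Q + K) * p) + K * ((Q + K) * p)
                                                 ≡⟨ e₃ Q K ((Q + K) * p) (Q * q) y ⟩
  Q * q * (Q + K) + suc y * K * ((Q + K) * p)    ∎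
  where
  open ≤-Reasoning
  p = (Q + K) ^ y
  q = Q ^ y
  e₁ : ∀ Q K p → (Q + K) * p * (Q + K) ≡ Q * (p * (Q + K)) + K * ((Q + K) * p)
  e₁ = solve-∀
  e₂ : ∀ Q K p q y → Q * (q * (Q + K) + y * K * p) ≤ Q * q * (Q + K) + y * K * ((Q + K) * p)
  e₂ Q K p q y = begin
    Q * (q * (Q + K) + y * K * p)                       ≤⟨ m≤m+n _ (y * K * (K * p)) ⟩
    Q * (q * (Q + K) + y * K * p) + y * K * (K * p)     ≡⟨ e₄ Q K p q y ⟩
    Q * q * (Q + K) + y * K * ((Q + K) * p)             ∎
    where
    e₄ : ∀ Q K p q y → Q * (q * (Q + K) + y * K * p) + y * K * (K * p) ≡ Q * q * (Q + K) + y * K * ((Q + K) * p)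
    e₄ = solve-∀
  e₃ : ∀ Q K p q y → q * (Q + K) + y * K * p + K * p ≡ q * (Q + K) + (1 + y) * K * p
  e₃ = solve-∀

-- By Bernoulli, `(Q/(Q + K))^y` is at least 1/2 once `yK` is at most half of `Q + K`. It serves
-- twice: for the loss in the isoperimetric inequality and for the growth of the potential in the
-- choice of `E`.
power-doubling : ∀ Q K y .{{_ : NonZero (Q + K)}} → 2 * (y * K) ≤ Q + K → (Q + K) ^ y ≤ 2 * Q ^ y
power-doubling Q K y small = *-cancelʳ-≤ ((Q + K) ^ y) (2 * Q ^ y) (Q + K)
  (+-cancelʳ-≤ (p * (Q + K)) (p * (Q + K)) (2 * Q ^ y * (Q + K)) (begin
    p * (Q + K) + p * (Q + K)                                     ≡⟨ e₁ (p * (Q + K)) ⟩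
    2 * (p * (Q + K))                                             ≤⟨ *-monoʳ-≤ 2 (bernoulli Q K y) ⟩
    2 * (Q ^ y * (Q + K) + y * K * p)                             ≡⟨ e₂ (Q ^ y) (Q + K) (y * K) p ⟩
    2 * Q ^ y * (Q + K) + p * (2 * (y * K))                       ≤⟨ +-monoʳ-≤ (2 * Q ^ y * (Q + K)) (*-monoʳ-≤ p small) ⟩
    2 * Q ^ y * (Q + K) + p * (Q + K)                             ∎))
  where
  open ≤-Reasoning
  p = (Q + K) ^ y
  e₁ : ∀ x → x + x ≡ 2 * x
  e₁ = solve-∀
  e₂ : ∀ q s t p → 2 * (q * s + t * p) ≡ 2 * q * s + p * (2 * t)
  e₂ = solve-∀

^-distribʳ-* : ∀ m n k → (m * n) ^ k ≡ m ^ k * n ^ k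
^-distribʳ-* m n zero    = refl
^-distribʳ-* m n (suc k) rewrite ^-distribʳ-* m n k = e m n (m ^ k) (n ^ k)
  where
  e : ∀ a b c d → a * b * (c * d) ≡ a * c * (b * d)
  e = solve-∀

n<2^n : ∀ n → n < 2 ^ n
n<2^n zero    = s≤s z≤n
n<2^n (suc n) = begin-strict
  1 + n            <⟨ s≤s (n<2^n n) ⟩
  1 + 2 ^ n        ≤⟨ +-monoˡ-≤ (2 ^ n) (m^n>0 2 n) ⟩
  2 ^ n + 2 ^ n    ≡⟨ cong (2 ^ n +_) (sym (+-identityʳ _)) ⟩
  2 * 2 ^ n        ∎
  where open ≤-Reasoning

-- Isoperimetry in Hamming space

words : List A → ∀ N → List (Vec A N)
words as zero    = [] ∷ []
words as (suc N) = cartesianProductWith _∷_ as (words as N)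

∑-words-suc : ∀ (as : List A) N (f : Vec A (suc N) → ℕ) →
  ∑ (words as (suc N)) f ≡ ∑ as (λ a → ∑ (words as N) (λ x → f (a ∷ x)))
∑-words-suc as N f = ∑-cartesianProductWith _∷_ as (words as N) f

length-words : ∀ (as : List A) N → length (words as N) ≡ length as ^ N
length-words as zero    = refl
length-words as (suc N) = begin
  length (words as (suc N))               ≡⟨ ∑-length (words as (suc N)) ⟨
  ∑ (words as (suc N)) (λ _ → 1)          ≡⟨ ∑-words-suc as N (λ _ → 1) ⟩
  ∑ as (λ _ → ∑ (words as N) (λ _ → 1))   ≡⟨ ∑-const as _ ⟩
  length as * ∑ (words as N) (λ _ → 1)    ≡⟨ cong (length as *_) (trans (∑-length (words as N)) (length-words as N)) ⟩
  length as ^ suc N                       ∎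
  where open ≡-Reasoning

module Hamming {A : Set} (_≟_ : DecidableEquality A) where

  mismatch : A → A → ℕ
  mismatch a b = ⟦ not (does (a ≟ b)) ⟧

  hamming : ∀ {N} → Vec A N → Vec A N → ℕ
  hamming []      []      = 0
  hamming (a ∷ x) (b ∷ y) = mismatch a b + hamming x y

  mismatch≡0⇒≡ : ∀ a b → mismatch a b ≡ 0 → a ≡ b
  mismatch≡0⇒≡ a b eq with a ≟ b
  ... | yes a≡b = a≡b

  mismatch-≢ : ∀ {a b} → a ≢ b → mismatch a b ≡ 1
  mismatch-≢ {a} {b} a≢b with a ≟ b
  ... | yes a≡b = contradiction a≡b a≢b
  ... | no  _   = refl

  mismatch-refl : ∀ a → mismatch a a ≡ 0
  mismatch-refl a with a ≟ a
  ... | yes _   = refl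
  ... | no  a≢a = contradiction refl a≢a

  mismatch≤1 : ∀ a b → mismatch a b ≤ 1
  mismatch≤1 a b = ⟦⟧≤1 (not (does (a ≟ b)))

  mismatch-sym : ∀ a b → mismatch a b ≡ mismatch b a
  mismatch-sym a b with a ≟ b
  ... | yes refl = sym (mismatch-refl a)
  ... | no  a≢b  = sym (mismatch-≢ (a≢b ∘ sym))

  mismatch-triangle : ∀ a b c → mismatch a c ≤ mismatch a b + mismatch b c
  mismatch-triangle a b c with a ≟ b
  ... | yes refl = ≤-refl
  ... | no  _    = ≤-trans (mismatch≤1 a c) (s≤s z≤n)

  hamming-sym : ∀ {N} (x y : Vec A N) → hamming x y ≡ hamming y x
  hamming-sym []      []      = refl
  hamming-sym (a ∷ x) (b ∷ y) = cong₂ _+_ (mismatch-sym a b) (hamming-sym x y)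

  hamming-triangle : ∀ {N} (x y z : Vec A N) → hamming x z ≤ hamming x y + hamming y z
  hamming-triangle []      []      []      = z≤n
  hamming-triangle (a ∷ x) (b ∷ y) (c ∷ z) = begin
    mismatch a c + hamming x z
      ≤⟨ +-mono-≤ (mismatch-triangle a b c) (hamming-triangle x y z) ⟩
    mismatch a b + mismatch b c + (hamming x y + hamming y z)
      ≡⟨ interchange (mismatch a b) _ _ _ ⟩
    mismatch a b + hamming x y + (mismatch b c + hamming y z)  ∎
    where
    open ≤-Reasoning
    interchange : ∀ a b c d → a + b + (c + d) ≡ a + c + (b + d)
    interchange = solve-∀

  hamming≡∑ : ∀ {N} (x y : Vec A N) → hamming x y ≡ ∑ (allFin N) (λ κ → mismatch (lookup x κ) (lookup y κ))
  hamming≡∑ []      []      = refl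
  hamming≡∑ {suc N} (a ∷ x) (b ∷ y) =
    trans (cong (mismatch a b +_) (hamming≡∑ x y)) (sym (∑-allFin-suc N (λ κ → mismatch (lookup (a ∷ x) κ) (lookup (b ∷ y) κ))))

  module _ (as : List A) (z : ℕ) .{{_ : NonZero z}} where

    private
      c = length as

      -- From (G − X)(G − Y) ≥ 0 one gets G(X + Y) ≤ G² + XY.
      sum≤square+product : ∀ G X Y → X ≤ G → Y ≤ G → G * (X + Y) ≤ G * G + X * Y
      sum≤square+product G X Y X≤G Y≤G with m≤n⇒∃[o]m+o≡n X≤G
      ... | o , refl = begin
        (X + o) * (X + Y)                  ≡⟨ e₁ X Y o ⟩
        (X + o) * X + X * Y + o * Y        ≤⟨ +-monoʳ-≤ ((X + o) * X + X * Y) (*-monoʳ-≤ o Y≤G) ⟩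
        (X + o) * X + X * Y + o * (X + o)  ≡⟨ e₂ X Y o ⟩
        (X + o) * (X + o) + X * Y          ∎
        where
        open ≤-Reasoning
        e₁ : ∀ X Y o → (X + o) * (X + Y) ≡ (X + o) * X + X * Y + o * Y
        e₁ = solve-∀
        e₂ : ∀ X Y o → (X + o) * X + X * Y + o * (X + o) ≡ (X + o) * (X + o) + X * Y
        e₂ = solve-∀

      -- With `s = (1 + z)/z`, `(sM − p)(sM − q) ≥ 0` and `pq ≤ M²` give `sM(p + q) ≤ (s² + 1)M²`,
      -- hence `p + q ≤ (s + 1/s)M`; the numerator of `s + 1/s` is `z² + (1 + z)² = 1 + 2z(1 + z)`.
      -- The division by `M` is why `M = 0` is treated apart.
      off-diagonal : ∀ M p q → z * p ≤ (1 + z) * M → z * q ≤ (1 + z) * M → p * q ≤ M * M →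
                     z * (1 + z) * (p + q) ≤ (1 + 2 * z * (1 + z)) * M
      off-diagonal zero p q zp≤ zq≤ _ = begin
        z * (1 + z) * (p + q)              ≡⟨ e z p q ⟩
        (1 + z) * (z * p + z * q)          ≤⟨ *-monoʳ-≤ (1 + z) (+-mono-≤ zp≤ zq≤) ⟩
        (1 + z) * ((1 + z) * 0 + (1 + z) * 0) ≡⟨ e′ z ⟩
        (1 + 2 * z * (1 + z)) * 0          ∎
        where
        open ≤-Reasoning
        e : ∀ z p q → z * (1 + z) * (p + q) ≡ (1 + z) * (z * p + z * q)
        e = solve-∀
        e′ : ∀ z → (1 + z) * ((1 + z) * 0 + (1 + z) * 0) ≡ (1 + 2 * z * (1 + z)) * 0
        e′ = solve-∀
      off-diagonal M@(suc _) p q zp≤ zq≤ pq≤ = *-cancelˡ-≤ M (begin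
        M * (z * (1 + z) * (p + q))                        ≡⟨ e₁ M z p q ⟩
        (1 + z) * M * (z * p + z * q)                      ≤⟨ sum≤square+product ((1 + z) * M) (z * p) (z * q) zp≤ zq≤ ⟩
        (1 + z) * M * ((1 + z) * M) + z * p * (z * q)      ≡⟨ e₂ M z p q ⟩
        (1 + z) * M * ((1 + z) * M) + z * z * (p * q)      ≤⟨ +-monoʳ-≤ ((1 + z) * M * ((1 + z) * M)) (*-monoʳ-≤ (z * z) pq≤) ⟩
        (1 + z) * M * ((1 + z) * M) + z * z * (M * M)      ≡⟨ e₃ M z ⟩
        M * ((1 + 2 * z * (1 + z)) * M)                    ∎)
        where
        open ≤-Reasoning
        e₁ : ∀ M z p q → M * (z * (1 + z) * (p + q)) ≡ (1 + z) * M * (z * p + z * q)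
        e₁ = solve-∀
        e₂ : ∀ M z p q → (1 + z) * M * ((1 + z) * M) + z * p * (z * q) ≡ (1 + z) * M * ((1 + z) * M) + z * z * (p * q)
        e₂ = solve-∀
        e₃ : ∀ M z → (1 + z) * M * ((1 + z) * M) + z * z * (M * M) ≡ M * ((1 + 2 * z * (1 + z)) * M)
        e₃ = solve-∀

    -- With s = 1 + 1/z: if f(x) g(y) ≤ K s^d(x,y) for all words x, y, then the product of the
    -- averages of f and g is at most K ((s + 1/s)/2)^N.
    isoperimetric : ∀ N (f g : Vec A N → ℕ) (k K : ℕ) →
      (∀ x y → k * (f x * g y) * z ^ hamming x y ≤ K * (1 + z) ^ hamming x y) →
      k * (∑ (words as N) f * ∑ (words as N) g) * (2 * z * (1 + z)) ^ N ≤ K * (c * c * (1 + 2 * z * (1 + z))) ^ N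
    isoperimetric zero f g k K H = begin
      k * ((f [] + 0) * (g [] + 0)) * 1   ≡⟨ cong₂ (λ a b → k * (a * b) * 1) (+-identityʳ (f [])) (+-identityʳ (g [])) ⟩
      k * (f [] * g []) * 1               ≤⟨ H [] [] ⟩
      K * 1                               ∎
      where open ≤-Reasoning
    isoperimetric (suc N) f g k K H = begin
      k * (∑ (words as (suc N)) f * ∑ (words as (suc N)) g) * (W₁ * W)
        ≡⟨ cong₂ (λ F G → k * (F * G) * (W₁ * W)) (∑-words-suc as N f) (∑-words-suc as N g) ⟩
      k * (∑ as F * ∑ as G) * (W₁ * W)
        ≡⟨ e₁ k (∑ as F * ∑ as G) z W ⟩
      -- Doubling the sum pairs `P a b` with `P b a`: a single off-diagonal term is only bounded by
      -- `sM`, but the two together by `(s + 1/s)M`.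
      z * (1 + z) * (k * W * (∑ as F * ∑ as G) + k * W * (∑ as F * ∑ as G))
        ≡⟨ cong (z * (1 + z) *_) (cong₂ _+_ double (trans double (∑-swap as as P))) ⟩
      z * (1 + z) * (∑ as (λ a → ∑ as (λ b → P a b)) + ∑ as (λ a → ∑ as (λ b → P b a)))
        ≡⟨ cong (z * (1 + z) *_) (sym (trans (∑-cong as (λ a → ∑-+ as (P a) (λ b → P b a))) (∑-+ as _ _))) ⟩
      z * (1 + z) * ∑ as (λ a → ∑ as (λ b → P a b + P b a))
        ≡⟨ sym (trans (∑-cong as (λ a → ∑-*ˡ as (z * (1 + z)) (λ b → P a b + P b a))) (∑-*ˡ as (z * (1 + z)) _)) ⟩
      ∑ as (λ a → ∑ as (λ b → z * (1 + z) * (P a b + P b a)))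
        ≤⟨ ∑-mono as (λ a → ∑-mono as (λ b → pair a b)) ⟩
      ∑ as (λ a → ∑ as (λ b → Q₁ * M))
        ≡⟨ trans (∑-cong as (λ a → ∑-const as (Q₁ * M))) (∑-const as _) ⟩
      c * (c * (Q₁ * (K * Q)))
        ≡⟨ e₂ c Q₁ K Q ⟩
      K * (c * c * Q₁ * Q) ∎
      where
      open ≤-Reasoning
      W₁ = 2 * z * (1 + z)
      W = W₁ ^ N
      Q₁ = 1 + 2 * z * (1 + z)
      Q = (c * c * Q₁) ^ N
      M = K * Q
      F G : A → ℕ
      F a = ∑ (words as N) (λ x → f (a ∷ x))
      G a = ∑ (words as N) (λ x → g (a ∷ x))
      P : A → A → ℕ
      P a b = k * W * (F a * G b)
      e₁ : ∀ k S z W → k * S * (2 * z * (1 + z) * W) ≡ z * (1 + z) * (k * W * S + k * W * S)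
      e₁ = solve-∀
      e₂ : ∀ c Q₁ K Q → c * (c * (Q₁ * (K * Q))) ≡ K * (c * c * Q₁ * Q)
      e₂ = solve-∀
      double : k * W * (∑ as F * ∑ as G) ≡ ∑ as (λ a → ∑ as (λ b → P a b))
      double = sym (trans (∑-cong as (λ a → trans (∑-*ˡ as (k * W) (λ b → F a * G b)) (cong (k * W *_) (∑-*ˡ as (F a) G))))
                          (trans (∑-*ˡ as (k * W) (λ a → F a * ∑ as G)) (cong (k * W *_) (∑-*ʳ as (∑ as G) F))))
      swap-factors : ∀ k W S → k * W * S ≡ k * S * W
      swap-factors = solve-∀
      diagonal : ∀ a → P a a ≤ M
      diagonal a = subst (_≤ M) (sym (swap-factors k W (F a * G a)))
        (isoperimetric N (λ x → f (a ∷ x)) (λ y → g (a ∷ y)) k K λ x y →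
          subst (λ m → k * (f (a ∷ x) * g (a ∷ y)) * z ^ (m + hamming x y) ≤ K * (1 + z) ^ (m + hamming x y))
                (mismatch-refl a) (H (a ∷ x) (a ∷ y)))
      -- A differing first letter costs one factor `(1 + z)/z`, absorbed by passing from `k` and `K`
      -- to `z * k` and `(1 + z) * K`; this is why both constants are carried through the induction.
      apart : ∀ {a b} → a ≢ b → z * P a b ≤ (1 + z) * M
      apart {a} {b} a≢b = begin
        z * (k * W * (F a * G b))         ≡⟨ e₃ z k W (F a * G b) ⟩
        z * k * (F a * G b) * W           ≤⟨ isoperimetric N (λ x → f (a ∷ x)) (λ y → g (b ∷ y)) (z * k) ((1 + z) * K) hyp ⟩
        (1 + z) * K * Q                   ≡⟨ *-assoc (1 + z) K Q ⟩
        (1 + z) * M                       ∎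
        where
        e₃ : ∀ z k W S → z * (k * W * S) ≡ z * k * S * W
        e₃ = solve-∀
        e₄ : ∀ z k S Z → z * k * S * Z ≡ k * S * (z * Z)
        e₄ = solve-∀
        e₅ : ∀ z K Z → K * ((1 + z) * Z) ≡ (1 + z) * K * Z
        e₅ = solve-∀
        hyp : ∀ x y → z * k * (f (a ∷ x) * g (b ∷ y)) * z ^ hamming x y ≤ (1 + z) * K * (1 + z) ^ hamming x y
        hyp x y = begin
          z * k * (f (a ∷ x) * g (b ∷ y)) * z ^ hamming x y      ≡⟨ e₄ z k _ _ ⟩
          k * (f (a ∷ x) * g (b ∷ y)) * z ^ (1 + hamming x y)    ≤⟨ subst (λ m → k * (f (a ∷ x) * g (b ∷ y)) * z ^ (m + hamming x y) ≤ K * (1 + z) ^ (m + hamming x y))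
                                                                    (mismatch-≢ a≢b) (H (a ∷ x) (b ∷ y)) ⟩
          K * (1 + z) ^ (1 + hamming x y)                        ≡⟨ e₅ z K _ ⟩
          (1 + z) * K * (1 + z) ^ hamming x y                    ∎
      pair : ∀ a b → z * (1 + z) * (P a b + P b a) ≤ Q₁ * M
      pair a b with a ≟ b
      ... | yes refl = begin
        z * (1 + z) * (P a a + P a a)    ≤⟨ *-monoʳ-≤ (z * (1 + z)) (+-mono-≤ (diagonal a) (diagonal a)) ⟩
        z * (1 + z) * (M + M)            ≡⟨ e₆ z M ⟩
        2 * z * (1 + z) * M              ≤⟨ *-monoˡ-≤ M (n≤1+n (2 * z * (1 + z))) ⟩
        Q₁ * M                           ∎
        where
        e₆ : ∀ z M → z * (1 + z) * (M + M) ≡ 2 * z * (1 + z) * M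
        e₆ = solve-∀
      -- The product `P a b * P b a` equals `P a a * P b b`, so the diagonal bounds control it.
      ... | no a≢b = off-diagonal M (P a b) (P b a) (apart a≢b) (apart (a≢b ∘ sym))
        (subst (_≤ M * M) (e₇ k W (F a) (G b) (F b) (G a)) (*-mono-≤ (diagonal a) (diagonal b)))
        where
        e₇ : ∀ k W Fa Gb Fb Ga → k * W * (Fa * Ga) * (k * W * (Fb * Gb)) ≡ k * W * (Fa * Gb) * (k * W * (Fb * Ga))
        e₇ = solve-∀

-- Concentration of measure for words of length z²

words-complete : ∀ (as : List A) → (∀ a → a ∈ as) → ∀ {N} (x : Vec A N) → x ∈ words as N
words-complete as complete []      = here refl
words-complete as complete (a ∷ x) = ∈-cartesianProductWith⁺ _∷_ (complete a) (words-complete as complete x)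

-- Bernoulli for `(1 + 1/z)^z`: `linear y` is the bound `1 + y/z ≤ (1 + 1/z)^y`, taken at `y = z`.
self-power-doubling : ∀ z .{{_ : NonZero z}} → 2 * z ^ z ≤ (1 + z) ^ z
self-power-doubling z = *-cancelˡ-≤ z (begin
  z * (2 * z ^ z)     ≡⟨ e z (z ^ z) ⟩
  (z + z) * z ^ z     ≤⟨ linear z ⟩
  z * (1 + z) ^ z     ∎)
  where
  open ≤-Reasoning
  e : ∀ z p → z * (2 * p) ≡ (z + z) * p
  e = solve-∀
  e₁ : ∀ z y p → (z + suc y) * (z * p) ≡ z * ((z + y) * p) + z * p
  e₁ = solve-∀
  e₂ : ∀ z p → z * (z * p) + z * p ≡ z * ((1 + z) * p)
  e₂ = solve-∀
  e₃ : ∀ z → (z + 0) * 1 ≡ z * 1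
  e₃ = solve-∀
  linear : ∀ y → (z + y) * z ^ y ≤ z * (1 + z) ^ y
  linear zero    = ≤-reflexive (e₃ z)
  linear (suc y) = begin
    (z + suc y) * (z * z ^ y)                  ≡⟨ e₁ z y (z ^ y) ⟩
    z * ((z + y) * z ^ y) + z * z ^ y          ≤⟨ +-mono-≤ (*-monoʳ-≤ z (linear y)) (*-monoʳ-≤ z (^-monoˡ-≤ y (n≤1+n z))) ⟩
    z * (z * (1 + z) ^ y) + z * (1 + z) ^ y    ≡⟨ e₂ z ((1 + z) ^ y) ⟩
    z * ((1 + z) * (1 + z) ^ y)                ∎

module Concentration {A : Set} (_≟_ : DecidableEquality A) (as : List A) (complete : ∀ a → a ∈ as)
  (z C : ℕ) .{{_ : NonZero z}} where

  open Hamming _≟_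

  private
    N = z * z
    D = C * z
    c = length as
    Q = 2 * z * (1 + z)

    instance
      1+Q≢0 : NonZero (Q + 1)
      1+Q≢0 = >-nonZero (m≤n+m 1 Q)
      1+Q≢0′ : NonZero Q
      1+Q≢0′ = m*n≢0 (2 * z) (1 + z) {{m*n≢0 2 z}}
      Q^N≢0 : NonZero (Q ^ N)
      Q^N≢0 = m^n≢0 Q N
      z^D≢0 : NonZero (z ^ D)
      z^D≢0 = m^n≢0 z D

  -- At distance more than `D`, the indicators satisfy the hypothesis of `isoperimetric` with
  -- `K/k = s^(−D)`, `s = 1 + 1/z`. Here `s^(Cz) ≥ 2^C`, while over `z²` letters the factor
  -- `(1 + 1/(2z(1 + z)))^(z²)` stays below 2.
  far-sets : ∀ (f g : Vec A N → Bool) → (∀ x y → f x ≡ true → g y ≡ true → D < hamming x y) →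
             2 ^ C * (∑ (words as N) (⟦_⟧ ∘ f) * ∑ (words as N) (⟦_⟧ ∘ g)) ≤ 2 * (c ^ N * c ^ N)
  far-sets f g far = *-cancelʳ-≤ _ _ (z ^ D * Q ^ N) {{m*n≢0 (z ^ D) (Q ^ N)}} (begin
    2 ^ C * S * (z ^ D * Q ^ N)             ≡⟨ e₁ (2 ^ C) S (z ^ D) (Q ^ N) ⟩
    2 ^ C * z ^ D * S * Q ^ N               ≤⟨ *-monoˡ-≤ (Q ^ N) (*-monoˡ-≤ S powers) ⟩
    (1 + z) ^ D * S * Q ^ N                 ≤⟨ isoperimetric as z N (⟦_⟧ ∘ f) (⟦_⟧ ∘ g) ((1 + z) ^ D) (z ^ D) pointwise ⟩
    z ^ D * (c * c * (1 + Q)) ^ N           ≡⟨ cong (z ^ D *_) (trans (^-distribʳ-* (c * c) (1 + Q) N) (cong₂ _*_ (^-distribʳ-* c c N) (cong (_^ N) (+-comm 1 Q)))) ⟩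
    z ^ D * (c ^ N * c ^ N * (Q + 1) ^ N)   ≤⟨ *-monoʳ-≤ (z ^ D) (*-monoʳ-≤ (c ^ N * c ^ N) (power-doubling Q 1 N small)) ⟩
    z ^ D * (c ^ N * c ^ N * (2 * Q ^ N))   ≡⟨ e₂ (z ^ D) (c ^ N) (Q ^ N) ⟩
    2 * (c ^ N * c ^ N) * (z ^ D * Q ^ N)   ∎)
    where
    open ≤-Reasoning
    S = ∑ (words as N) (⟦_⟧ ∘ f) * ∑ (words as N) (⟦_⟧ ∘ g)
    e₁ : ∀ t S z q → t * S * (z * q) ≡ t * z * S * q
    e₁ = solve-∀
    e₂ : ∀ z c q → z * (c * c * (2 * q)) ≡ 2 * (c * c) * (z * q)
    e₂ = solve-∀
    small : 2 * (N * 1) ≤ Q + 1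
    small = subst (2 * (N * 1) ≤_) (e₃ z) (m≤m+n (2 * (z * z * 1)) (2 * z + 1))
      where
      e₃ : ∀ z → 2 * (z * z * 1) + (2 * z + 1) ≡ 2 * z * (1 + z) + 1
      e₃ = solve-∀
    powers : 2 ^ C * z ^ D ≤ (1 + z) ^ D
    powers = begin
      2 ^ C * z ^ (C * z)    ≡⟨ cong (λ d → 2 ^ C * z ^ d) (*-comm C z) ⟩
      2 ^ C * z ^ (z * C)    ≡⟨ cong (2 ^ C *_) (^-*-assoc z z C) ⟨
      2 ^ C * (z ^ z) ^ C    ≡⟨ ^-distribʳ-* 2 (z ^ z) C ⟨
      (2 * z ^ z) ^ C        ≤⟨ ^-monoˡ-≤ C (self-power-doubling z) ⟩
      ((1 + z) ^ z) ^ C      ≡⟨ ^-*-assoc (1 + z) z C ⟩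
      (1 + z) ^ (z * C)      ≡⟨ cong ((1 + z) ^_) (*-comm z C) ⟩
      (1 + z) ^ (C * z)      ∎
    pointwise : ∀ x y → (1 + z) ^ D * (⟦ f x ⟧ * ⟦ g y ⟧) * z ^ hamming x y ≤ z ^ D * (1 + z) ^ hamming x y
    pointwise x y with f x in fx | g y in gy
    ... | false | _     = ≤-trans (≤-reflexive (cong (_* z ^ hamming x y) (*-zeroʳ ((1 + z) ^ D)))) z≤n
    ... | true  | false = ≤-trans (≤-reflexive (cong (_* z ^ hamming x y) (*-zeroʳ ((1 + z) ^ D)))) z≤n
    ... | true  | true  with m≤n⇒∃[o]m+o≡n (<⇒≤ (far x y fx gy))
    ...   | o , eq = begin
      (1 + z) ^ D * 1 * z ^ hamming x y      ≡⟨ cong₂ _*_ (*-identityʳ ((1 + z) ^ D)) (cong (z ^_) (sym eq)) ⟩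
      (1 + z) ^ D * z ^ (D + o)              ≡⟨ cong ((1 + z) ^ D *_) (^-distribˡ-+-* z D o) ⟩
      (1 + z) ^ D * (z ^ D * z ^ o)          ≤⟨ *-monoʳ-≤ ((1 + z) ^ D) (*-monoʳ-≤ (z ^ D) (^-monoˡ-≤ o (n≤1+n z))) ⟩
      (1 + z) ^ D * (z ^ D * (1 + z) ^ o)    ≡⟨ e₄ ((1 + z) ^ D) (z ^ D) ((1 + z) ^ o) ⟩
      z ^ D * ((1 + z) ^ D * (1 + z) ^ o)    ≡⟨ cong (z ^ D *_) (^-distribˡ-+-* (1 + z) D o) ⟨
      z ^ D * (1 + z) ^ (D + o)              ≡⟨ cong (λ d → z ^ D * (1 + z) ^ d) eq ⟩
      z ^ D * (1 + z) ^ hamming x y          ∎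
      where
      e₄ : ∀ a b c → a * (b * c) ≡ b * (a * c)
      e₄ = solve-∀

  -- The words farther than `D` from a set of density at least `1/e` have density at most `2e/2^C`,
  -- and `r` such exceptional sets are too small to cover all words.
  common-neighbour : ∀ {r} e (𝒜 : Fin r → Vec A N → Bool) → 0 < c → r * (2 * e) < 2 ^ C →
    (∀ j → c ^ N ≤ e * ∑ (words as N) (⟦_⟧ ∘ 𝒜 j)) →
    ∃ λ x → ∀ j → ∃ λ a → 𝒜 j a ≡ true × hamming a x ≤ D
  common-neighbour {r} e 𝒜 c>0 r2e<2^C dense = conclude (∑-<length⇒∃≡0 (words as N) few-far)
    where
    open ≤-Reasoning
    near? : ∀ j x → Dec (Any (λ a → 𝒜 j a ≡ true × hamming a x ≤ D) (words as N))
    near? j x = any? (λ a → (𝒜 j a Bool.≟ true) ×-dec (hamming a x ≤? D)) (words as N)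
    far : Fin r → Vec A N → Bool
    far j x = not (does (near? j x))
    far⇒ : ∀ j x y → 𝒜 j x ≡ true → far j y ≡ true → D < hamming x y
    far⇒ j x y 𝒜x fy with near? j y
    ... | no ¬near = ≰⇒> λ d≤D → ¬near (lose (words-complete as complete x) (𝒜x , d≤D))
    instance
      c^N≢0 : NonZero (c ^ N)
      c^N≢0 = m^n≢0 c N {{>-nonZero c>0}}
    bound : ∀ j → 2 ^ C * ∑ (words as N) (⟦_⟧ ∘ far j) ≤ 2 * e * c ^ N
    bound j = *-cancelʳ-≤ _ _ (c ^ N) (begin
      2 ^ C * F * c ^ N            ≤⟨ *-monoʳ-≤ (2 ^ C * F) (dense j) ⟩
      2 ^ C * F * (e * S)          ≡⟨ e₁ (2 ^ C) F e S ⟩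
      e * (2 ^ C * (S * F))        ≤⟨ *-monoʳ-≤ e (far-sets (𝒜 j) (far j) (far⇒ j)) ⟩
      e * (2 * (c ^ N * c ^ N))    ≡⟨ e₂ e (c ^ N) ⟩
      2 * e * c ^ N * c ^ N        ∎)
      where
      F = ∑ (words as N) (⟦_⟧ ∘ far j)
      S = ∑ (words as N) (⟦_⟧ ∘ 𝒜 j)
      e₁ : ∀ t F e S → t * F * (e * S) ≡ e * (t * (S * F))
      e₁ = solve-∀
      e₂ : ∀ e c → e * (2 * (c * c)) ≡ 2 * e * c * c
      e₂ = solve-∀
    few-far : ∑ (words as N) (λ x → ∑ (allFin r) (λ j → ⟦ far j x ⟧)) < length (words as N)
    few-far = *-cancelˡ-< (2 ^ C) _ _ (begin-strict
      2 ^ C * ∑ (words as N) (λ x → ∑ (allFin r) (λ j → ⟦ far j x ⟧))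
        ≡⟨ cong (2 ^ C *_) (∑-swap (words as N) (allFin r) (λ x j → ⟦ far j x ⟧)) ⟩
      2 ^ C * ∑ (allFin r) (λ j → ∑ (words as N) (⟦_⟧ ∘ far j))
        ≡⟨ ∑-*ˡ (allFin r) (2 ^ C) _ ⟨
      ∑ (allFin r) (λ j → 2 ^ C * ∑ (words as N) (⟦_⟧ ∘ far j))
        ≤⟨ ∑-mono (allFin r) bound ⟩
      ∑ (allFin r) (λ _ → 2 * e * c ^ N)
        ≡⟨ trans (∑-const (allFin r) _) (cong (_* (2 * e * c ^ N)) (length-tabulate {n = r} id)) ⟩
      r * (2 * e * c ^ N)
        ≡⟨ *-assoc r (2 * e) (c ^ N) ⟨
      r * (2 * e) * c ^ N
        <⟨ *-monoˡ-< (c ^ N) r2e<2^C ⟩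
      2 ^ C * c ^ N
        ≡⟨ cong (2 ^ C *_) (length-words as N) ⟨
      2 ^ C * length (words as N) ∎)
    close : ∀ j x → ⟦ far j x ⟧ ≡ 0 → ∃ λ a → 𝒜 j a ≡ true × hamming a x ≤ D
    close j x eq with near? j x
    ... | yes near = satisfied near
    conclude : (∃ λ x → ∑ (allFin r) (λ j → ⟦ far j x ⟧) ≡ 0) → ∃ λ x → ∀ j → ∃ λ a → 𝒜 j a ≡ true × hamming a x ≤ D
    conclude (x , none) = x , λ j → close j x (∑≡0⇒≡0-Fin (λ j → ⟦ far j x ⟧) none j)

-- Anticoncentration in the cube

bits : List Bool
bits = true ∷ false ∷ []

cube : ∀ N → List (Vec Bool N)
cube = words bits

weight : ∀ {N} → Vec Bool N → ℕ
weight []      = 0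
weight (b ∷ x) = ⟦ b ⟧ + weight x

∑-cube-suc : ∀ N (f : Vec Bool (suc N) → ℕ) →
  ∑ (cube (suc N)) f ≡ ∑ (cube N) (f ∘ (true ∷_)) + ∑ (cube N) (f ∘ (false ∷_))
∑-cube-suc N f = trans (∑-words-suc bits N f) (cong (∑ (cube N) (f ∘ (true ∷_)) +_) (+-identityʳ _))

infixl 6 _⊕_
_⊕_ : ∀ {N} → Vec Bool N → Vec Bool N → Vec Bool N
_⊕_ = zipWith _xor_

∑-cube-⊕ : ∀ {N} (y : Vec Bool N) (f : Vec Bool N → ℕ) → ∑ (cube N) (λ x → f (x ⊕ y)) ≡ ∑ (cube N) f
∑-cube-⊕ []      f = refl
∑-cube-⊕ {suc N} (true ∷ y) f = begin
  ∑ (cube (suc N)) (λ x → f (x ⊕ (true ∷ y)))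
    ≡⟨ ∑-cube-suc N _ ⟩
  ∑ (cube N) (λ x → f (false ∷ (x ⊕ y))) + ∑ (cube N) (λ x → f (true ∷ (x ⊕ y)))
    ≡⟨ cong₂ _+_ (∑-cube-⊕ y (f ∘ (false ∷_))) (∑-cube-⊕ y (f ∘ (true ∷_))) ⟩
  ∑ (cube N) (f ∘ (false ∷_)) + ∑ (cube N) (f ∘ (true ∷_))
    ≡⟨ +-comm (∑ (cube N) (f ∘ (false ∷_))) _ ⟩
  ∑ (cube N) (f ∘ (true ∷_)) + ∑ (cube N) (f ∘ (false ∷_))
    ≡⟨ ∑-cube-suc N f ⟨
  ∑ (cube (suc N)) f ∎
  where open ≡-Reasoning
∑-cube-⊕ {suc N} (false ∷ y) f = begin
  ∑ (cube (suc N)) (λ x → f (x ⊕ (false ∷ y)))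
    ≡⟨ ∑-cube-suc N _ ⟩
  ∑ (cube N) (λ x → f (true ∷ (x ⊕ y))) + ∑ (cube N) (λ x → f (false ∷ (x ⊕ y)))
    ≡⟨ cong₂ _+_ (∑-cube-⊕ y (f ∘ (true ∷_))) (∑-cube-⊕ y (f ∘ (false ∷_))) ⟩
  ∑ (cube N) (f ∘ (true ∷_)) + ∑ (cube N) (f ∘ (false ∷_))
    ≡⟨ ∑-cube-suc N f ⟨
  ∑ (cube (suc N)) f ∎
  where open ≡-Reasoning

ones : ∀ N → Vec Bool N
ones N = Vec.replicate N true

weight-complement : ∀ {N} (x : Vec Bool N) → weight x + weight (x ⊕ ones N) ≡ N
weight-complement []          = refl
weight-complement (true ∷ x)  = cong suc (weight-complement x)
weight-complement (false ∷ x) = trans (+-suc (weight x) _) (cong suc (weight-complement x))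

-- The binomial coefficient, as the size of a level of the cube, so that levels can be summed
-- directly against other counts on the cube.
shell : ℕ → ℕ → ℕ
shell N c = ∑ (cube N) (λ x → ⟦ weight x ≡ᵇ c ⟧)

shell-suc-zero : ∀ N → shell (suc N) 0 ≡ shell N 0
shell-suc-zero N = trans (∑-cube-suc N _)
  (cong (_+ shell N 0) (trans (∑-const (cube N) 0) (*-zeroʳ (length (cube N)))))

pascal : ∀ N c → shell (suc N) (suc c) ≡ shell N c + shell N (suc c)
pascal N c = ∑-cube-suc N _

-- The identity `(c + 1) C(N, c + 1) = (N − c) C(N, c)` freed of subtraction; Pascal's rule reduces
-- it to two instances at `N`.
absorption : ∀ N c → suc c * shell N (suc c) + c * shell N c ≡ N * shell N c
absorption zero zero    = refl
absorption zero (suc c) = cong₂ _+_ (*-zeroʳ c) (*-zeroʳ c)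
absorption (suc N) zero rewrite pascal N 0 | shell-suc-zero N = begin
  shell N 0 + shell N 1 + 0 + 0         ≡⟨ e (shell N 0) (shell N 1) ⟩
  shell N 0 + (1 * shell N 1 + 0)       ≡⟨ cong (shell N 0 +_) (absorption N 0) ⟩
  shell N 0 + N * shell N 0             ∎
  where
  open ≡-Reasoning
  e : ∀ a b → a + b + 0 + 0 ≡ a + (1 * b + 0)
  e = solve-∀
absorption (suc N) (suc c) rewrite pascal N c | pascal N (suc c) = begin
  (2 + c) * (y + w) + (1 + c) * (x + y)                     ≡⟨ e₁ c x y w ⟩
  ((1 + c) * y + c * x) + ((2 + c) * w + (1 + c) * y) + (x + y) ≡⟨ cong₂ (λ s t → s + t + (x + y)) (absorption N c) (absorption N (suc c)) ⟩
  N * x + N * y + (x + y)                                   ≡⟨ e₂ N x y ⟩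
  (1 + N) * (x + y)                                         ∎
  where
  open ≡-Reasoning
  x = shell N c
  y = shell N (suc c)
  w = shell N (suc (suc c))
  e₁ : ∀ c x y w → (2 + c) * (y + w) + (1 + c) * (x + y) ≡ ((1 + c) * y + c * x) + ((2 + c) * w + (1 + c) * y) + (x + y)
  e₁ = solve-∀
  e₂ : ∀ N x y → N * x + N * y + (x + y) ≡ (1 + N) * (x + y)
  e₂ = solve-∀

shell-increasing : ∀ N c → suc (c + c) ≤ N → shell N c ≤ shell N (suc c)
shell-increasing N c 2c<N = *-cancelˡ-≤ (suc c) (+-cancelʳ-≤ (c * shell N c) _ _ (begin
  suc c * shell N c + c * shell N c          ≡⟨ *-distribʳ-+ (shell N c) (suc c) c ⟨
  suc (c + c) * shell N c                    ≤⟨ *-monoˡ-≤ (shell N c) 2c<N ⟩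
  N * shell N c                              ≡⟨ absorption N c ⟨
  suc c * shell N (suc c) + c * shell N c    ∎))
  where open ≤-Reasoning

shell-decreasing : ∀ N c → N ≤ c + c → shell N (suc c) ≤ shell N c
shell-decreasing N c N≤2c = *-cancelˡ-≤ (suc c) (+-cancelʳ-≤ (c * shell N c) _ _ (begin
  suc c * shell N (suc c) + c * shell N c    ≡⟨ absorption N c ⟩
  N * shell N c                              ≤⟨ *-monoˡ-≤ (shell N c) (≤-trans N≤2c (n≤1+n (c + c))) ⟩
  suc (c + c) * shell N c                    ≡⟨ *-distribʳ-+ (shell N c) (suc c) c ⟩
  suc c * shell N c + c * shell N c          ∎))
  where open ≤-Reasoning

central : ℕ → ℕ
central h = shell (h + h) h

shell≤central : ∀ h c → shell (h + h) c ≤ central h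
shell≤central h c with ≤-total c h
... | inj₁ c≤h with m≤n⇒∃[o]m+o≡n c≤h
...   | o , eq = below o c eq
  where
  below : ∀ o c → c + o ≡ h → shell (h + h) c ≤ central h
  below zero    c eq = ≤-reflexive (cong (shell (h + h)) (trans (sym (+-identityʳ c)) eq))
  below (suc o) c eq = ≤-trans (shell-increasing (h + h) c (+-mono-≤ c<h (<⇒≤ c<h))) (below o (suc c) (trans (sym (+-suc c o)) eq))
    where
    c<h : c < h
    c<h = subst (c <_) eq (m<m+n c (s≤s z≤n))
shell≤central h c | inj₂ h≤c with m≤n⇒∃[o]m+o≡n h≤c
... | o , refl = above o
  where
  above : ∀ o → shell (h + h) (h + o) ≤ central h
  above zero    = ≤-reflexive (cong (shell (h + h)) (+-identityʳ h))
  above (suc o) = ≤-trans (≤-reflexive (cong (shell (h + h)) (+-suc h o)))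
    (≤-trans (shell-decreasing (h + h) (h + o) (+-mono-≤ (m≤m+n h o) (m≤m+n h o))) (above o))

central-suc : ∀ h → suc h * central (suc h) ≡ 2 * (1 + 2 * h) * central h
central-suc h = begin
  suc h * shell (suc h + suc h) (suc h)           ≡⟨ cong (λ n → suc h * shell (suc n) (suc h)) (+-suc h h) ⟩
  suc h * shell (2 + (h + h)) (suc h)             ≡⟨ cong (suc h *_) (pascal (1 + (h + h)) h) ⟩
  suc h * (shell (1 + (h + h)) h + shell (1 + (h + h)) (suc h)) ≡⟨ cong (λ s → suc h * (s + shell (1 + (h + h)) (suc h))) (sym middle) ⟩
  suc h * (shell (1 + (h + h)) (suc h) + shell (1 + (h + h)) (suc h)) ≡⟨ cong (λ s → suc h * (s + s)) (pascal (h + h) h) ⟩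
  suc h * ((c + d) + (c + d))                     ≡⟨ e₁ h c d ⟩
  2 * (suc h * c + suc h * d)                     ≡⟨ cong (λ s → 2 * (suc h * c + s)) next ⟩
  2 * (suc h * c + h * c)                         ≡⟨ e₂ h c ⟩
  2 * (1 + 2 * h) * c                             ∎
  where
  open ≡-Reasoning
  c = central h
  d = shell (h + h) (suc h)
  e₁ : ∀ h c d → (1 + h) * ((c + d) + (c + d)) ≡ 2 * ((1 + h) * c + (1 + h) * d)
  e₁ = solve-∀
  e₂ : ∀ h c → 2 * ((1 + h) * c + h * c) ≡ 2 * (1 + 2 * h) * c
  e₂ = solve-∀
  -- The symmetry of the two middle coefficients of an odd row is read off from `absorption`.
  middle : shell (1 + (h + h)) (suc h) ≡ shell (1 + (h + h)) h
  middle = *-cancelˡ-≡ _ _ (suc h) (+-cancelʳ-≡ (h * shell (1 + (h + h)) h) _ _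
    (trans (absorption (1 + (h + h)) h) (*-distribʳ-+ (shell (1 + (h + h)) h) (suc h) h)))
  next : suc h * d ≡ h * c
  next = +-cancelʳ-≡ (h * c) _ _ (trans (absorption (h + h) h) (*-distribʳ-+ c h h))

-- The squared form of `C(2h, h) ≤ 4^h/√(2h + 1)`; the induction step is
-- `(2h + 1)(2h + 3) ≤ (2h + 2)²`.
central-bound : ∀ h → central h * central h * (1 + 2 * h) ≤ 16 ^ h
central-bound zero    = s≤s z≤n
central-bound (suc h) = *-cancelˡ-≤ (suc h * suc h) (begin
  suc h * suc h * (c′ * c′ * (1 + 2 * suc h))                          ≡⟨ e₁ h c′ ⟩
  (suc h * c′) * (suc h * c′) * (1 + 2 * suc h)                        ≡⟨ cong (λ s → s * s * (1 + 2 * suc h)) (central-suc h) ⟩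
  (2 * (1 + 2 * h) * c) * (2 * (1 + 2 * h) * c) * (1 + 2 * suc h)      ≡⟨ e₂ h c ⟩
  4 * ((1 + 2 * h) * (3 + 2 * h)) * (c * c * (1 + 2 * h))              ≤⟨ *-mono-≤ {4 * ((1 + 2 * h) * (3 + 2 * h))} {4 * ((1 + 2 * h) * (3 + 2 * h) + 1)} (*-monoʳ-≤ 4 (m≤m+n ((1 + 2 * h) * (3 + 2 * h)) 1)) (central-bound h) ⟩
  4 * ((1 + 2 * h) * (3 + 2 * h) + 1) * 16 ^ h                         ≡⟨ e₃ h (16 ^ h) ⟩
  suc h * suc h * (16 * 16 ^ h)                                        ∎)
  where
  open ≤-Reasoning
  c = central h
  c′ = central (suc h)
  e₁ : ∀ h c → (1 + h) * (1 + h) * (c * c * (1 + 2 * (1 + h))) ≡ ((1 + h) * c) * ((1 + h) * c) * (1 + 2 * (1 + h))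
  e₁ = solve-∀
  e₂ : ∀ h c → (2 * (1 + 2 * h) * c) * (2 * (1 + 2 * h) * c) * (1 + 2 * (1 + h)) ≡ 4 * ((1 + 2 * h) * (3 + 2 * h)) * (c * c * (1 + 2 * h))
  e₂ = solve-∀
  e₃ : ∀ h p → 4 * ((1 + 2 * h) * (3 + 2 * h) + 1) * p ≡ (1 + h) * (1 + h) * (16 * p)
  e₃ = solve-∀

square-cancel-≤ : ∀ {x y} → x * x ≤ y * y → x ≤ y
square-cancel-≤ xx≤yy = ≮⇒≥ λ y<x → <⇒≱ (*-mono-< y<x y<x) xx≤yy

light : ∀ (a h : ℕ) {N} → Vec Bool N → Bool
light a h x = weight x + a <ᵇ h

lights : (a h : ℕ) → ℕ
lights a h = ∑ (cube (h + h)) (⟦_⟧ ∘ light a h)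

⟦⟧-true : ∀ {b} → T b → 1 ≤ ⟦ b ⟧
⟦⟧-true {true} _ = s≤s z≤n

-- A word is light, has a light complement, or lies in one of the 2a + 1 middle shells.
cube-split : ∀ a h → a ≤ h → 2 ^ (h + h) ≤ 2 * lights a h + (1 + (a + a)) * central h
cube-split a h a≤h with m≤n⇒∃[o]m+o≡n a≤h
... | o , eq = begin
  2 ^ (h + h)
    ≡⟨ length-words bits (h + h) ⟨
  length (cube (h + h))
    ≡⟨ ∑-length (cube (h + h)) ⟨
  ∑ (cube (h + h)) (λ _ → 1)
    ≤⟨ ∑-mono (cube (h + h)) cover ⟩
  ∑ (cube (h + h)) (λ x → ⟦ light a h x ⟧ + ⟦ light a h (x ⊕ ones (h + h)) ⟧ + ∑ (allFin (1 + (a + a))) (λ d → ⟦ weight x ≡ᵇ toℕ d + o ⟧))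
    ≡⟨ ∑-+ (cube (h + h)) _ _ ⟩
  ∑ (cube (h + h)) (λ x → ⟦ light a h x ⟧ + ⟦ light a h (x ⊕ ones (h + h)) ⟧) + ∑ (cube (h + h)) (λ x → ∑ (allFin (1 + (a + a))) (λ d → ⟦ weight x ≡ᵇ toℕ d + o ⟧))
    ≡⟨ cong₂ _+_ (∑-+ (cube (h + h)) _ _) (∑-swap (cube (h + h)) (allFin (1 + (a + a))) (λ x d → ⟦ weight x ≡ᵇ toℕ d + o ⟧)) ⟩
  lights a h + ∑ (cube (h + h)) (λ x → ⟦ light a h (x ⊕ ones (h + h)) ⟧) + ∑ (allFin (1 + (a + a))) (λ d → shell (h + h) (toℕ d + o))
    ≤⟨ +-mono-≤ (≤-reflexive (cong (lights a h +_) (∑-cube-⊕ (ones (h + h)) (⟦_⟧ ∘ light a h))))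
                (∑-mono (allFin (1 + (a + a))) (λ d → shell≤central h (toℕ d + o))) ⟩
  lights a h + lights a h + ∑ (allFin (1 + (a + a))) (λ _ → central h)
    ≡⟨ cong₂ _+_ (cong (lights a h +_) (sym (+-identityʳ (lights a h))))
                 (trans (∑-const (allFin (1 + (a + a))) (central h)) (cong (_* central h) (length-tabulate {n = 1 + (a + a)} id))) ⟩
  2 * lights a h + (1 + (a + a)) * central h ∎
  where
  open ≤-Reasoning
  cover : ∀ x → 1 ≤ ⟦ light a h x ⟧ + ⟦ light a h (x ⊕ ones (h + h)) ⟧ + ∑ (allFin (1 + (a + a))) (λ d → ⟦ weight x ≡ᵇ toℕ d + o ⟧)
  cover x with suc (weight x + a) ≤? h | suc (weight (x ⊕ ones (h + h)) + a) ≤? h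
  ... | yes lt | _ = ≤-trans (⟦⟧-true (<⇒<ᵇ lt)) (≤-trans (m≤m+n _ _) (m≤m+n _ _))
  ... | no _ | yes lt = ≤-trans (⟦⟧-true (<⇒<ᵇ lt)) (≤-trans (m≤n+m _ ⟦ light a h x ⟧) (m≤m+n _ _))
  ... | no ≮₁ | no ≮₂ with m≤n⇒∃[o]m+o≡n (+-cancelʳ-≤ a o (weight x) (subst (_≤ weight x + a) (trans (sym eq) (+-comm a o)) (≮⇒≥ ≮₁)))
  ...   | d , o+d≡w = ≤-trans (⟦⟧-true (≡⇒≡ᵇ (weight x) (toℕ d′ + o) (trans (sym o+d≡w) (trans (+-comm o d) (cong (_+ o) (sym (Fin.toℕ-fromℕ< d<)))))))
                        (≤-trans (≤∑-∈ (λ d → ⟦ weight x ≡ᵇ toℕ d + o ⟧) (∈-allFin d′)) (m≤n+m _ (⟦ light a h x ⟧ + ⟦ light a h (x ⊕ ones (h + h)) ⟧)))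
    where
    w≤ : weight x ≤ h + a
    w≤ = +-cancelʳ-≤ h (weight x) (h + a) (begin
      weight x + h                                      ≤⟨ +-monoʳ-≤ (weight x) (≮⇒≥ ≮₂) ⟩
      weight x + (weight (x ⊕ ones (h + h)) + a)        ≡⟨ +-assoc (weight x) _ a ⟨
      weight x + weight (x ⊕ ones (h + h)) + a          ≡⟨ cong (_+ a) (weight-complement x) ⟩
      h + h + a                                         ≡⟨ e₁ h a ⟩
      h + a + h                                         ∎)
      where
      e₁ : ∀ h a → h + h + a ≡ h + a + h
      e₁ = solve-∀
    d< : d < 1 + (a + a)
    d< = s≤s (+-cancelˡ-≤ o d (a + a) (begin
      o + d        ≡⟨ o+d≡w ⟩
      weight x     ≤⟨ w≤ ⟩
      h + a        ≡⟨ cong (_+ a) eq ⟨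
      a + o + a    ≡⟨ e₂ a o ⟩
      o + (a + a)  ∎))
      where
      e₂ : ∀ a o → a + o + a ≡ o + (a + a)
      e₂ = solve-∀
    d′ = fromℕ< d<

-- Since `2h = (2βz)²`, each shell holds at most a fraction `1/(2βz)` of the cube. The `2a + 1 ≤ 4a`
-- middle shells, `a = αz`, thus hold at most `4αz/(2βz) = 1/μ` of it.
anticoncentration : ∀ α μ z .{{_ : NonZero α}} .{{_ : NonZero μ}} .{{_ : NonZero z}} →
  let β = 2 * α * μ ; h = 2 * (β * β) * (z * z) in
  μ * 2 ^ (h + h) ≤ μ * (2 * lights (α * z) h) + 2 ^ (h + h)
anticoncentration α μ z = begin
  μ * 2 ^ (h + h)                                                  ≤⟨ *-monoʳ-≤ μ (cube-split a h a≤h) ⟩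
  μ * (2 * lights a h + (1 + (a + a)) * central h)                 ≡⟨ *-distribˡ-+ μ _ _ ⟩
  μ * (2 * lights a h) + μ * ((1 + (a + a)) * central h)           ≤⟨ +-monoʳ-≤ (μ * (2 * lights a h)) middle ⟩
  μ * (2 * lights a h) + 2 ^ (h + h)                               ∎
  where
  open ≤-Reasoning
  β = 2 * α * μ
  h = 2 * (β * β) * (z * z)
  a = α * z
  instance
    a≢0 : NonZero a
    a≢0 = m*n≢0 α z
    a*μ≢0 : NonZero (8 * (a * (μ * μ)))
    a*μ≢0 = m*n≢0 8 (a * (μ * μ)) {{_}} {{m*n≢0 a (μ * μ) {{a≢0}} {{m*n≢0 μ μ}}}}
  a≤h : a ≤ h
  a≤h = subst (a ≤_) (e α μ z) (m≤m*n a (8 * (a * (μ * μ))))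
    where
    e : ∀ α μ z → α * z * (8 * (α * z * (μ * μ))) ≡ 2 * (2 * α * μ * (2 * α * μ)) * (z * z)
    e = solve-∀
  16^ : 16 ^ h ≡ 2 ^ (h + h) * 2 ^ (h + h)
  16^ = trans (^-distribʳ-* 4 4 h) (cong₂ _*_ 4^ 4^)
    where
    4^ : 4 ^ h ≡ 2 ^ (h + h)
    4^ = trans (^-distribʳ-* 2 2 h) (sym (^-distribˡ-+-* 2 h h))
  root : central h * (2 * β * z) ≤ 2 ^ (h + h)
  root = square-cancel-≤ (begin
    central h * (2 * β * z) * (central h * (2 * β * z))    ≡⟨ e (central h) β z ⟩
    central h * central h * (2 * (2 * (β * β) * (z * z)))  ≤⟨ *-monoʳ-≤ (central h * central h) (n≤1+n (2 * h)) ⟩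
    central h * central h * (1 + 2 * h)                    ≤⟨ central-bound h ⟩
    16 ^ h                                                 ≡⟨ 16^ ⟩
    2 ^ (h + h) * 2 ^ (h + h)                              ∎)
    where
    e : ∀ c β z → c * (2 * β * z) * (c * (2 * β * z)) ≡ c * c * (2 * (2 * (β * β) * (z * z)))
    e = solve-∀
  middle : μ * ((1 + (a + a)) * central h) ≤ 2 ^ (h + h)
  middle = begin
    μ * ((1 + (a + a)) * central h)        ≤⟨ *-monoʳ-≤ μ (*-monoˡ-≤ (central h) (+-monoˡ-≤ (a + a) (≤-trans (>-nonZero⁻¹ a) (m≤m+n a a)))) ⟩
    μ * ((a + a + (a + a)) * central h)    ≡⟨ e α μ z (central h) ⟩
    central h * (2 * (2 * α * μ) * z)      ≤⟨ root ⟩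
    2 ^ (h + h)                            ∎
    where
    e : ∀ α μ z c → μ * ((α * z + α * z + (α * z + α * z)) * c) ≡ c * (2 * (2 * α * μ) * z)
    e = solve-∀

-- A sparse incidence structure

length-cartesianProduct : ∀ (xs : List A) (ys : List B) → length (cartesianProduct xs ys) ≡ length xs * length ys
length-cartesianProduct xs ys = begin
  length (cartesianProduct xs ys)          ≡⟨ ∑-length (cartesianProduct xs ys) ⟨
  ∑ (cartesianProduct xs ys) (λ _ → 1)     ≡⟨ ∑-cartesianProductWith _,_ xs ys (λ _ → 1) ⟩
  ∑ xs (λ _ → ∑ ys (λ _ → 1))              ≡⟨ ∑-const xs _ ⟩
  length xs * ∑ ys (λ _ → 1)               ≡⟨ cong (length xs *_) (∑-length ys) ⟩
  length xs * length ys                    ∎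
  where open ≡-Reasoning

∑≤length*⇒∃ : ∀ (xs : List A) {f : A → ℕ} M → 0 < length xs → ∑ xs f ≤ length xs * M → ∃ λ x → f x ≤ M
∑≤length*⇒∃ xs {f} M xs≢[] le = proj₁ found , ≤-pred (proj₂ found)
  where
  open ≤-Reasoning
  found : ∃ λ x → f x < suc M
  found = ∑-<⇒∃ xs {f} {λ _ → suc M} (begin-strict
    ∑ xs f               ≤⟨ le ⟩
    length xs * M        <⟨ *-monoʳ-< (length xs) {{>-nonZero xs≢[]}} (n<1+n M) ⟩
    length xs * suc M    ≡⟨ ∑-const xs (suc M) ⟨
    ∑ xs (λ _ → suc M)   ∎)

-- The method of conditional expectations: the choices are made one at a time, never letting the
-- potential ∑ Z^hits grow by more than its average factor α/β.
module Derandomise {P C : Set} (Ps : List P) (Cs : List C) (hit : P → C → Bool) (Z α β : ℕ)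
  (Cs≢[] : 0 < length Cs)
  (average : ∀ p → β * ∑ Cs (λ c → Z ^ ⟦ hit p c ⟧) ≤ length Cs * α) where

  hits : ∀ {N} → P → Vec C N → ℕ
  hits p []      = 0
  hits p (c ∷ E) = ⟦ hit p c ⟧ + hits p E

  hits≡∑ : ∀ {N} p (E : Vec C N) → hits p E ≡ ∑ (allFin N) (λ k → ⟦ hit p (lookup E k) ⟧)
  hits≡∑ p []              = refl
  hits≡∑ {suc N} p (c ∷ E) = trans (cong (⟦ hit p c ⟧ +_) (hits≡∑ p E))
    (sym (∑-allFin-suc N (λ k → ⟦ hit p (lookup (c ∷ E) k) ⟧)))

  choose : ∀ N → ∃ λ (E : Vec C N) → β ^ N * ∑ Ps (λ p → Z ^ hits p E) ≤ α ^ N * length Ps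
  choose zero = [] , ≤-reflexive (cong (_+ 0) (∑-length Ps))
  choose (suc N) with choose N
  ... | E , bound = extend (∑≤length*⇒∃ Cs (α * ∑ Ps w) Cs≢[] total)
    where
    open ≤-Reasoning
    w : P → ℕ
    w p = Z ^ hits p E
    e₁ : ∀ b x y → b * (x * y) ≡ y * (b * x)
    e₁ = solve-∀
    e₂ : ∀ y l a → y * (l * a) ≡ l * a * y
    e₂ = solve-∀
    total : ∑ Cs (λ c → β * ∑ Ps (λ p → Z ^ ⟦ hit p c ⟧ * w p)) ≤ length Cs * (α * ∑ Ps w)
    total = begin
      ∑ Cs (λ c → β * ∑ Ps (λ p → Z ^ ⟦ hit p c ⟧ * w p))
        ≡⟨ ∑-cong Cs (λ c → sym (∑-*ˡ Ps β (λ p → Z ^ ⟦ hit p c ⟧ * w p))) ⟩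
      ∑ Cs (λ c → ∑ Ps (λ p → β * (Z ^ ⟦ hit p c ⟧ * w p)))
        ≡⟨ ∑-swap Cs Ps (λ c p → β * (Z ^ ⟦ hit p c ⟧ * w p)) ⟩
      ∑ Ps (λ p → ∑ Cs (λ c → β * (Z ^ ⟦ hit p c ⟧ * w p)))
        ≡⟨ ∑-cong Ps (λ p → trans (∑-cong Cs (λ c → e₁ β (Z ^ ⟦ hit p c ⟧) (w p)))
             (trans (∑-*ˡ Cs (w p) (λ c → β * Z ^ ⟦ hit p c ⟧)) (cong (w p *_) (∑-*ˡ Cs β (λ c → Z ^ ⟦ hit p c ⟧))))) ⟩
      ∑ Ps (λ p → w p * (β * ∑ Cs (λ c → Z ^ ⟦ hit p c ⟧)))
        ≤⟨ ∑-mono Ps (λ p → *-monoʳ-≤ (w p) (average p)) ⟩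
      ∑ Ps (λ p → w p * (length Cs * α))
        ≡⟨ ∑-*ʳ Ps (length Cs * α) w ⟩
      ∑ Ps w * (length Cs * α)
        ≡⟨ trans (e₂ (∑ Ps w) (length Cs) α) (*-assoc (length Cs) α (∑ Ps w)) ⟩
      length Cs * (α * ∑ Ps w) ∎
    extend : (∃ λ c → β * ∑ Ps (λ p → Z ^ ⟦ hit p c ⟧ * w p) ≤ α * ∑ Ps w) →
             ∃ λ (E : Vec C (suc N)) → β ^ suc N * ∑ Ps (λ p → Z ^ hits p E) ≤ α ^ suc N * length Ps
    extend (c , le) = c ∷ E , (begin
      β * β ^ N * ∑ Ps (λ p → Z ^ (⟦ hit p c ⟧ + hits p E))
        ≡⟨ cong (β * β ^ N *_) (∑-cong Ps (λ p → ^-distribˡ-+-* Z ⟦ hit p c ⟧ (hits p E))) ⟩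
      β * β ^ N * ∑ Ps (λ p → Z ^ ⟦ hit p c ⟧ * w p)
        ≡⟨ e₃ β (β ^ N) _ ⟩
      β ^ N * (β * ∑ Ps (λ p → Z ^ ⟦ hit p c ⟧ * w p))
        ≤⟨ *-monoʳ-≤ (β ^ N) le ⟩
      β ^ N * (α * ∑ Ps w)
        ≡⟨ e₁′ (β ^ N) α (∑ Ps w) ⟩
      α * (β ^ N * ∑ Ps w)
        ≤⟨ *-monoʳ-≤ α bound ⟩
      α * (α ^ N * length Ps)
        ≡⟨ *-assoc α (α ^ N) (length Ps) ⟨
      α * α ^ N * length Ps ∎)
      where
      e₃ : ∀ b p s → b * p * s ≡ p * (b * s)
      e₃ = solve-∀
      e₁′ : ∀ b x y → b * (x * y) ≡ x * (b * y)
      e₁′ = solve-∀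

mem : ∀ {n τ} → Fin n → Vec (Fin n) τ → Bool
mem i []      = false
mem i (s ∷ S) = does (i Fin.≟ s) ∨ mem i S

∑-does-≟ : ∀ {n} (s : Fin n) → ∑ (allFin n) (λ i → ⟦ does (i Fin.≟ s) ⟧) ≡ 1
∑-does-≟ {suc n} zero    = trans (∑-allFin-suc n (λ i → ⟦ does (i Fin.≟ zero) ⟧)) (cong suc (trans (∑-const (allFin n) 0) (*-zeroʳ (length (allFin n)))))
∑-does-≟ {suc n} (suc s) = trans (∑-allFin-suc n (λ i → ⟦ does (i Fin.≟ suc s) ⟧)) (∑-does-≟ s)

∑-mem : ∀ {n τ} (S : Vec (Fin n) τ) → ∑ (allFin n) (λ i → ⟦ mem i S ⟧) ≤ τ
∑-mem {n} []      = ≤-reflexive (trans (∑-const (allFin n) 0) (*-zeroʳ (length (allFin n))))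
∑-mem {n} {suc τ} (s ∷ S) = begin
  ∑ (allFin n) (λ i → ⟦ does (i Fin.≟ s) ∨ mem i S ⟧)                          ≤⟨ ∑-mono (allFin n) (λ i → ⟦∨⟧ (does (i Fin.≟ s)) (mem i S)) ⟩
  ∑ (allFin n) (λ i → ⟦ does (i Fin.≟ s) ⟧ + ⟦ mem i S ⟧)                      ≡⟨ ∑-+ (allFin n) _ _ ⟩
  ∑ (allFin n) (λ i → ⟦ does (i Fin.≟ s) ⟧) + ∑ (allFin n) (λ i → ⟦ mem i S ⟧) ≤⟨ +-mono-≤ (≤-reflexive (∑-does-≟ s)) (∑-mem S) ⟩
  suc τ ∎
  where
  open ≤-Reasoning
  ⟦∨⟧ : ∀ a b → ⟦ a ∨ b ⟧ ≤ ⟦ a ⟧ + ⟦ b ⟧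
  ⟦∨⟧ true  b = s≤s z≤n
  ⟦∨⟧ false b = ≤-refl

-- Only a cover is wanted, so short lists are padded with the arbitrary `i₀`. This turns small sets
-- into words of length exactly `τ`, which are easy to enumerate and count.
mem-cover : ∀ {n} (p : Fin n → Bool) (i₀ : Fin n) τ (xs : List (Fin n)) → ∑ xs (⟦_⟧ ∘ p) ≤ τ →
            ∃ λ (S : Vec (Fin n) τ) → ∀ {i} → i ∈ xs → p i ≡ true → mem i S ≡ true
mem-cover p i₀ τ [] _ = Vec.replicate τ i₀ , λ ()
mem-cover p i₀ τ (x ∷ xs) le with p x in px
... | false with mem-cover p i₀ τ xs le
...   | S , covers = S , λ { (here refl) pi → contradiction (trans (sym pi) px) λ () ; (there i∈) pi → covers i∈ pi }
mem-cover p i₀ (suc τ) (x ∷ xs) (s≤s le) | true with mem-cover p i₀ τ xs le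
...   | S , covers = x ∷ S , λ { (here refl) _ → ≟-refl x ; {i} (there i∈) pi → trans (cong (does (i Fin.≟ x) ∨_) (covers i∈ pi)) (Bool.∨-zeroʳ (does (i Fin.≟ x))) }
  where
  ≟-refl : ∀ x → does (x Fin.≟ x) ∨ mem x S ≡ true
  ≟-refl x with x Fin.≟ x
  ... | yes _   = refl
  ... | no  x≢x = contradiction refl x≢x

⟦∧⟧ : ∀ a b → ⟦ a ∧ b ⟧ ≡ ⟦ a ⟧ * ⟦ b ⟧
⟦∧⟧ true  b = sym (+-identityʳ ⟦ b ⟧)
⟦∧⟧ false b = refl

∧-true⁻ : ∀ {a b} → a ∧ b ≡ true → a ≡ true × b ≡ true
∧-true⁻ {true} {true} refl = refl , refl

^-cancelʳ-≤ : ∀ z {x y} → 1 < z → z ^ x ≤ z ^ y → x ≤ y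
^-cancelʳ-≤ z 1<z le = ≮⇒≥ λ y<x → <⇒≱ (^-monoʳ-< z 1<z y<x) le

module Sparse (c K y m N : ℕ) .{{_ : NonZero K}} .{{_ : NonZero y}} (K≡ : K ≡ 4 * (c * c)) (N≡ : N ≡ y * m)
  (2^m≤ : 2 ^ m ≤ (2 * K * y) ^ (2 * K * y)) where

  private
    z = 2 * K * y
    n = z * z
    τ = 2 * (c * z)

    instance
      2K≢0 : NonZero (2 * K)
      2K≢0 = m*n≢0 2 K
      z≢0 : NonZero z
      z≢0 = m*n≢0 (2 * K) y
      n≢0 : NonZero n
      n≢0 = m*n≢0 z z
      z+K≢0 : NonZero (z + K)
      z+K≢0 = >-nonZero (≤-trans (>-nonZero⁻¹ z) (m≤m+n z K))

    1<z : 1 < z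
    1<z = *-mono-≤ {2} {2 * K} {1} {y} (*-monoʳ-≤ 2 (>-nonZero⁻¹ K)) (>-nonZero⁻¹ y)

    sets : List (Vec (Fin n) τ)
    sets = words (allFin n) τ

    hit : Vec (Fin n) τ × Vec (Fin n) τ → Fin n × Fin n → Bool
    hit (S , S′) (i , i′) = mem i S ∧ mem i′ S′

    lengthF : length (allFin n) ≡ n
    lengthF = length-tabulate {n = n} id

    pairs : List (Fin n × Fin n)
    pairs = cartesianProduct (allFin n) (allFin n)

    length-pairs : length pairs ≡ n * n
    length-pairs = trans (length-cartesianProduct (allFin n) (allFin n)) (cong₂ _*_ lengthF lengthF)

    -- A uniformly random pair hits with probability at most `(τ/n)² = 4c²/z² = K/z²`, so `z^hit`
    -- has mean at most `1 + z(K/z²) = 1 + K/z`.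
    average : ∀ p → z * ∑ pairs (λ q → z ^ ⟦ hit p q ⟧) ≤ length pairs * (z + K)
    average (S , S′) = begin
      z * ∑ pairs (λ q → z ^ ⟦ hit (S , S′) q ⟧)
        ≤⟨ *-monoʳ-≤ z (∑-mono pairs (λ q → one-or-z (hit (S , S′) q))) ⟩
      z * ∑ pairs (λ q → 1 + z * ⟦ hit (S , S′) q ⟧)
        ≡⟨ cong (z *_) (trans (∑-+ pairs (λ _ → 1) _) (cong₂ _+_ (trans (∑-length pairs) length-pairs) (∑-*ˡ pairs z _))) ⟩
      z * (n * n + z * ∑ pairs (λ q → ⟦ hit (S , S′) q ⟧))
        ≤⟨ *-monoʳ-≤ z (+-monoʳ-≤ (n * n) (*-monoʳ-≤ z hits≤)) ⟩
      z * (n * n + z * (τ * τ))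
        ≡⟨ e c z ⟩
      n * n * (z + 4 * (c * c))
        ≡⟨ cong₂ (λ l k → l * (z + k)) (sym length-pairs) (sym K≡) ⟩
      length pairs * (z + K) ∎
      where
      open ≤-Reasoning
      one-or-z : ∀ b → z ^ ⟦ b ⟧ ≤ 1 + z * ⟦ b ⟧
      one-or-z true  = n≤1+n (z * 1)
      one-or-z false = s≤s z≤n
      e : ∀ c z → z * (z * z * (z * z) + z * (2 * (c * z) * (2 * (c * z)))) ≡ z * z * (z * z) * (z + 4 * (c * c))
      e = solve-∀
      hits≤ : ∑ pairs (λ q → ⟦ hit (S , S′) q ⟧) ≤ τ * τ
      hits≤ = begin
        ∑ pairs (λ q → ⟦ hit (S , S′) q ⟧)
          ≡⟨ ∑-cartesianProductWith _,_ (allFin n) (allFin n) _ ⟩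
        ∑ (allFin n) (λ i → ∑ (allFin n) (λ i′ → ⟦ mem i S ∧ mem i′ S′ ⟧))
          ≡⟨ ∑-cong (allFin n) (λ i → trans (∑-cong (allFin n) (λ i′ → ⟦∧⟧ (mem i S) (mem i′ S′))) (∑-*ˡ (allFin n) ⟦ mem i S ⟧ (λ i′ → ⟦ mem i′ S′ ⟧))) ⟩
        ∑ (allFin n) (λ i → ⟦ mem i S ⟧ * ∑ (allFin n) (λ i′ → ⟦ mem i′ S′ ⟧))
          ≡⟨ ∑-*ʳ (allFin n) (∑ (allFin n) (λ i′ → ⟦ mem i′ S′ ⟧)) (λ i → ⟦ mem i S ⟧) ⟩
        ∑ (allFin n) (λ i → ⟦ mem i S ⟧) * ∑ (allFin n) (λ i′ → ⟦ mem i′ S′ ⟧)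
          ≤⟨ *-mono-≤ (∑-mem S) (∑-mem S′) ⟩
        τ * τ ∎

    open Derandomise (cartesianProduct sets sets) pairs hit z (z + K) z
      (subst (0 <_) (sym length-pairs) (>-nonZero⁻¹ (n * n) {{m*n≢0 n n}})) average

    -- Because `2Ky = z`, the factor `1 + K/z` at most doubles the potential in `y` choices, hence
    -- multiplies it by at most `2^m ≤ z^z` in all `N = ym`.
    growth : (z + K) ^ N ≤ z ^ (z + N)
    growth = begin
      (z + K) ^ N           ≡⟨ cong ((z + K) ^_) N≡ ⟩
      (z + K) ^ (y * m)     ≡⟨ ^-*-assoc (z + K) y m ⟨
      ((z + K) ^ y) ^ m     ≤⟨ ^-monoˡ-≤ m (power-doubling z K y small) ⟩
      (2 * z ^ y) ^ m       ≡⟨ ^-distribʳ-* 2 (z ^ y) m ⟩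
      2 ^ m * (z ^ y) ^ m   ≡⟨ cong (2 ^ m *_) (trans (^-*-assoc z y m) (cong (z ^_) (sym N≡))) ⟩
      2 ^ m * z ^ N         ≤⟨ *-monoˡ-≤ (z ^ N) 2^m≤ ⟩
      z ^ z * z ^ N         ≡⟨ ^-distribˡ-+-* z z N ⟨
      z ^ (z + N)           ∎
      where
      open ≤-Reasoning
      small : 2 * (y * K) ≤ z + K
      small = subst (_≤ z + K) (e K y) (m≤m+n z K)
        where
        e : ∀ K y → 2 * K * y ≡ 2 * (y * K)
        e = solve-∀

    length-sets² : length (cartesianProduct sets sets) ≡ z ^ (8 * c * z)
    length-sets² = begin
      length (cartesianProduct sets sets)   ≡⟨ length-cartesianProduct sets sets ⟩
      length sets * length sets             ≡⟨ cong (λ l → l * l) (trans (length-words (allFin n) τ) (cong (_^ τ) lengthF)) ⟩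
      n ^ τ * n ^ τ                         ≡⟨ cong (λ l → l * l) (trans (^-distribʳ-* z z τ) (sym (^-distribˡ-+-* z τ τ))) ⟩
      z ^ (τ + τ) * z ^ (τ + τ)             ≡⟨ ^-distribˡ-+-* z (τ + τ) (τ + τ) ⟨
      z ^ (τ + τ + (τ + τ))                 ≡⟨ cong (z ^_) (e c z) ⟩
      z ^ (8 * c * z)                       ∎
      where
      open ≡-Reasoning
      e : ∀ c z → 2 * (c * z) + 2 * (c * z) + (2 * (c * z) + 2 * (c * z)) ≡ 8 * c * z
      e = solve-∀

    i₀ : Fin n
    i₀ = fromℕ< (>-nonZero⁻¹ n)

  -- A union bound over `n^(2τ) = z^(8cz)` pairs of sets. With hits weighted by `z`, both this
  -- entropy and the growth `z^z` are powers of `z`, leaving at most `8cz + z` hits. The bound is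
  -- free of `N`, so the degree can be raised, within `2^m ≤ z^z`, without raising it.
  sparse-incidence : ∃ λ (E : Vec (Fin n × Fin n) N) → ∀ (p p′ : Fin n → Bool) →
    ∑ (allFin n) (⟦_⟧ ∘ p) ≤ τ → ∑ (allFin n) (⟦_⟧ ∘ p′) ≤ τ →
    ∑ (allFin N) (λ k → ⟦ p (proj₁ (lookup E k)) ∧ p′ (proj₂ (lookup E k)) ⟧) ≤ (8 * c + 1) * z
  sparse-incidence with choose N
  ... | E , bound = E , sparse
    where
    open ≤-Reasoning
    hits-bound : ∀ q → q ∈ cartesianProduct sets sets → hits q E ≤ (8 * c + 1) * z
    hits-bound q q∈ = ^-cancelʳ-≤ z 1<z (*-cancelˡ-≤ (z ^ N) {{m^n≢0 z N}} (begin
      z ^ N * z ^ hits q E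
        ≤⟨ *-monoʳ-≤ (z ^ N) (≤∑-∈ (λ q → z ^ hits q E) q∈) ⟩
      z ^ N * ∑ (cartesianProduct sets sets) (λ q → z ^ hits q E)
        ≤⟨ bound ⟩
      (z + K) ^ N * length (cartesianProduct sets sets)
        ≤⟨ *-mono-≤ growth (≤-reflexive length-sets²) ⟩
      z ^ (z + N) * z ^ (8 * c * z)
        ≡⟨ ^-distribˡ-+-* z (z + N) (8 * c * z) ⟨
      z ^ (z + N + 8 * c * z)
        ≡⟨ cong (z ^_) (e c z N) ⟩
      z ^ (N + (8 * c + 1) * z)
        ≡⟨ ^-distribˡ-+-* z N ((8 * c + 1) * z) ⟩
      z ^ N * z ^ ((8 * c + 1) * z) ∎))
      where
      e : ∀ c z N → z + N + 8 * c * z ≡ N + (8 * c + 1) * z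
      e = solve-∀
    sparse : ∀ (p p′ : Fin n → Bool) →
      ∑ (allFin n) (⟦_⟧ ∘ p) ≤ τ → ∑ (allFin n) (⟦_⟧ ∘ p′) ≤ τ →
      ∑ (allFin N) (λ k → ⟦ p (proj₁ (lookup E k)) ∧ p′ (proj₂ (lookup E k)) ⟧) ≤ (8 * c + 1) * z
    sparse p p′ small small′ with mem-cover p i₀ τ (allFin n) small | mem-cover p′ i₀ τ (allFin n) small′
    ... | S , covers | S′ , covers′ = begin
      ∑ (allFin N) (λ k → ⟦ p (proj₁ (lookup E k)) ∧ p′ (proj₂ (lookup E k)) ⟧)
        ≤⟨ ∑-mono (allFin N) (λ k → covered (lookup E k)) ⟩
      ∑ (allFin N) (λ k → ⟦ hit (S , S′) (lookup E k) ⟧)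
        ≡⟨ hits≡∑ (S , S′) E ⟨
      hits (S , S′) E
        ≤⟨ hits-bound (S , S′) (∈-cartesianProduct⁺ (words-complete (allFin n) ∈-allFin S) (words-complete (allFin n) ∈-allFin S′)) ⟩
      (8 * c + 1) * z ∎
      where
      covered : ∀ q → ⟦ p (proj₁ q) ∧ p′ (proj₂ q) ⟧ ≤ ⟦ hit (S , S′) q ⟧
      covered (i , i′) with p i in pi | p′ i′ in pi′
      ... | false | _     = z≤n
      ... | true  | false = z≤n
      ... | true  | true  rewrite covers (∈-allFin i) pi | covers′ (∈-allFin i′) pi′ = ≤-refl

-- Symbols and roles

⊕-involutive : ∀ {n} (x y : Vec Bool n) → x ⊕ y ⊕ y ≡ x
⊕-involutive []      []      = refl
⊕-involutive (a ∷ x) (b ∷ y) = cong₂ _∷_ (xor-involutive a b) (⊕-involutive x y)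
  where
  xor-involutive : ∀ a b → (a xor b) xor b ≡ a
  xor-involutive true  true  = refl
  xor-involutive true  false = refl
  xor-involutive false true  = refl
  xor-involutive false false = refl

⊕-comm : ∀ {n} (x y : Vec Bool n) → x ⊕ y ≡ y ⊕ x
⊕-comm []      []      = refl
⊕-comm (a ∷ x) (b ∷ y) = cong₂ _∷_ (Bool.xor-comm a b) (⊕-comm x y)

⊕-cancelʳ : ∀ {n} (x y z : Vec Bool n) → x ⊕ z ≡ y ⊕ z → x ≡ y
⊕-cancelʳ x y z eq = trans (sym (⊕-involutive x z)) (trans (cong (_⊕ z) eq) (⊕-involutive y z))

⊕-cancelˡ : ∀ {n} (x y z : Vec Bool n) → x ⊕ y ≡ x ⊕ z → y ≡ z
⊕-cancelˡ x y z eq = ⊕-cancelʳ y z x (trans (⊕-comm y x) (trans eq (⊕-comm x z)))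

-- Functions from `Vec Bool b` to `D`, encoded as nested pairs so that their equality is decidable
-- and they can be enumerated.
Table : Set → ℕ → Set
Table D zero    = D
Table D (suc b) = Table D b × Table D b

module _ {D : Set} where

  look : ∀ b → Vec Bool b → Table D b → D
  look zero    []          d       = d
  look (suc b) (true ∷ i)  (s , t) = look b i s
  look (suc b) (false ∷ i) (s , t) = look b i t

  adjust : ∀ b → Vec Bool b → (D → D) → Table D b → Table D b
  adjust zero    []          f d       = f d
  adjust (suc b) (true ∷ i)  f (s , t) = adjust b i f s , t
  adjust (suc b) (false ∷ i) f (s , t) = s , adjust b i f t

  look-adjust : ∀ b i f t → look b i (adjust b i f t) ≡ f (look b i t)
  look-adjust zero    []          f d       = refl
  look-adjust (suc b) (true ∷ i)  f (s , t) = look-adjust b i f s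
  look-adjust (suc b) (false ∷ i) f (s , t) = look-adjust b i f t

  look-adjust-≢ : ∀ b {i k} f t → k ≢ i → look b k (adjust b i f t) ≡ look b k t
  look-adjust-≢ zero    {[]}        {[]}        f d       k≢i = contradiction refl k≢i
  look-adjust-≢ (suc b) {true ∷ i}  {true ∷ k}  f (s , t) k≢i = look-adjust-≢ b f s (k≢i ∘ cong (true ∷_))
  look-adjust-≢ (suc b) {true ∷ i}  {false ∷ k} f (s , t) k≢i = refl
  look-adjust-≢ (suc b) {false ∷ i} {true ∷ k}  f (s , t) k≢i = refl
  look-adjust-≢ (suc b) {false ∷ i} {false ∷ k} f (s , t) k≢i = look-adjust-≢ b f t (k≢i ∘ cong (false ∷_))

  adjust-involutive : ∀ b i {f} → (∀ d → f (f d) ≡ d) → ∀ t → adjust b i f (adjust b i f t) ≡ t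
  adjust-involutive zero    []          inv d       = inv d
  adjust-involutive (suc b) (true ∷ i)  inv (s , t) = cong (_, t) (adjust-involutive b i inv s)
  adjust-involutive (suc b) (false ∷ i) inv (s , t) = cong (s ,_) (adjust-involutive b i inv t)

  table-≟ : DecidableEquality D → ∀ b → DecidableEquality (Table D b)
  table-≟ _≟_ zero    = _≟_
  table-≟ _≟_ (suc b) = Product.≡-dec (table-≟ _≟_ b) (table-≟ _≟_ b)

  tables : List D → ∀ b → List (Table D b)
  tables ds zero    = ds
  tables ds (suc b) = cartesianProduct (tables ds b) (tables ds b)

  tables-complete : ∀ ds → (∀ d → d ∈ ds) → ∀ b t → t ∈ tables ds b
  tables-complete ds complete zero    d       = complete d
  tables-complete ds complete (suc b) (s , t) =
    ∈-cartesianProduct⁺ (tables-complete ds complete b s) (tables-complete ds complete b t)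

  ∑-adjust : ∀ ds f → (∀ g → ∑ ds (g ∘ f) ≡ ∑ ds g) → ∀ b i (g : Table D b → ℕ) →
             ∑ (tables ds b) (g ∘ adjust b i f) ≡ ∑ (tables ds b) g
  ∑-adjust ds f inv zero    []          g = inv g
  ∑-adjust ds f inv (suc b) (true ∷ i)  g = begin
    ∑ (tables ds (suc b)) (g ∘ adjust (suc b) (true ∷ i) f)
      ≡⟨ ∑-cartesianProductWith _,_ (tables ds b) (tables ds b) _ ⟩
    ∑ (tables ds b) (λ s → ∑ (tables ds b) (λ t → g (adjust b i f s , t)))
      ≡⟨ ∑-adjust ds f inv b i (λ s → ∑ (tables ds b) (λ t → g (s , t))) ⟩
    ∑ (tables ds b) (λ s → ∑ (tables ds b) (λ t → g (s , t)))
      ≡⟨ ∑-cartesianProductWith _,_ (tables ds b) (tables ds b) g ⟨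
    ∑ (tables ds (suc b)) g ∎
    where open ≡-Reasoning
  ∑-adjust ds f inv (suc b) (false ∷ i) g = begin
    ∑ (tables ds (suc b)) (g ∘ adjust (suc b) (false ∷ i) f)
      ≡⟨ ∑-cartesianProductWith _,_ (tables ds b) (tables ds b) _ ⟩
    ∑ (tables ds b) (λ s → ∑ (tables ds b) (λ t → g (s , adjust b i f t)))
      ≡⟨ ∑-cong (tables ds b) (λ s → ∑-adjust ds f inv b i (λ t → g (s , t))) ⟩
    ∑ (tables ds b) (λ s → ∑ (tables ds b) (λ t → g (s , t)))
      ≡⟨ ∑-cartesianProductWith _,_ (tables ds b) (tables ds b) g ⟨
    ∑ (tables ds (suc b)) g ∎
    where open ≡-Reasoning

bits-complete : ∀ b → b ∈ bits
bits-complete true  = here refl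
bits-complete false = there (here refl)

cube-complete : ∀ {n} (x : Vec Bool n) → x ∈ cube n
cube-complete = words-complete bits bits-complete

unit : ∀ {r} → Fin r → Vec Bool r
unit j = Vec.tabulate (λ i → does (i Fin.≟ j))

unit-injective : ∀ {r} {j k : Fin r} → unit j ≡ unit k → j ≡ k
unit-injective {r} {j} {k} eq with j Fin.≟ k | trans (sym (Vec.lookup∘tabulate _ j)) (trans (cong (λ x → lookup x j) eq) (Vec.lookup∘tabulate _ j))
... | yes j≡k | _ = j≡k
... | no  _   | d≡ with j Fin.≟ j
...   | yes _   = contradiction d≡ λ ()
...   | no  j≢j = contradiction refl j≢j

-- A symbol (β , t , v) carries a colour β, a tag t and a table v. The r symbols act j c agree in
-- their tables except at one common index, where they are pairwise distinct, and index and tag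
-- together determine j. Two tables that differ in exactly one index recover that index, and in a
-- family of pairwise such tables the index is the same for all pairs; hence a clique of symbols
-- has well-defined roles j.
module Alphabet (r ℓ : ℕ) (σ : Fin r → Vec Bool ℓ) where

  Symbol : Set
  Symbol = Vec Bool ℓ × Vec Bool r × Table (Vec Bool r) r

  _≟ˢ_ : DecidableEquality Symbol
  _≟ˢ_ = Product.≡-dec (Vec.≡-dec Bool._≟_) (Product.≡-dec (Vec.≡-dec Bool._≟_) (table-≟ (Vec.≡-dec Bool._≟_) r))

  symbols : List Symbol
  symbols = cartesianProduct (cube ℓ) (cartesianProduct (cube r) (tables (cube r) r))

  symbols-complete : ∀ c → c ∈ symbols
  symbols-complete (β , t , v) = ∈-cartesianProduct⁺ (cube-complete β)
    (∈-cartesianProduct⁺ (cube-complete t) (tables-complete (cube r) cube-complete r v))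

  colour : Symbol → Vec Bool ℓ
  colour = proj₁

  -- `act j` uses the second component as the table index `i` and leaves the tag `i ⊕ unit j` in its
  -- place; `unact j` first recovers `i` from the tag. The map is thus a bijection, yet the tag
  -- reveals the index only to those who know the role.
  act unact : Fin r → Symbol → Symbol
  act   j (β , i , v) = β ⊕ σ j , i ⊕ unit j , adjust r i (_⊕ unit j) v
  unact j (β , t , v) = β ⊕ σ j , t ⊕ unit j , adjust r (t ⊕ unit j) (_⊕ unit j) v

  unact-act : ∀ j c → unact j (act j c) ≡ c
  unact-act j (β , i , v) = cong₂ _,_ (⊕-involutive β (σ j)) (cong₂ _,_ i≡
    (trans (cong (λ k → adjust r k (_⊕ unit j) (adjust r i (_⊕ unit j) v)) i≡)
           (adjust-involutive r i (λ d → ⊕-involutive d (unit j)) v)))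
    where
    i≡ = ⊕-involutive i (unit j)

  ∑-symbols : ∀ (f : Symbol → ℕ) → ∑ symbols f ≡ ∑ (cube ℓ) (λ β → ∑ (cube r) (λ t → ∑ (tables (cube r) r) (λ v → f (β , t , v))))
  ∑-symbols f = trans (∑-cartesianProductWith _,_ (cube ℓ) _ f)
    (∑-cong (cube ℓ) (λ β → ∑-cartesianProductWith _,_ (cube r) _ (λ tv → f (β , tv))))

  -- `act j` preserves the uniform measure, so the preimage of a dense set of words is equally
  -- dense. The table is undone first, while its index `i` is still fixed; then the tag and the
  -- colour are translated.
  ∑-act : ∀ j (f : Symbol → ℕ) → ∑ symbols (f ∘ act j) ≡ ∑ symbols f
  ∑-act j f = begin
    ∑ symbols (f ∘ act j)
      ≡⟨ ∑-symbols (f ∘ act j) ⟩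
    ∑ (cube ℓ) (λ β → ∑ (cube r) (λ i → ∑ (tables (cube r) r) (λ v → f (β ⊕ σ j , i ⊕ unit j , adjust r i (_⊕ unit j) v))))
      ≡⟨ ∑-cong (cube ℓ) (λ β → ∑-cong (cube r) (λ i → ∑-adjust (cube r) (_⊕ unit j) (∑-cube-⊕ (unit j)) r i (λ v → f (β ⊕ σ j , i ⊕ unit j , v)))) ⟩
    ∑ (cube ℓ) (λ β → ∑ (cube r) (λ i → ∑ (tables (cube r) r) (λ v → f (β ⊕ σ j , i ⊕ unit j , v))))
      ≡⟨ ∑-cong (cube ℓ) (λ β → ∑-cube-⊕ (unit j) (λ i → ∑ (tables (cube r) r) (λ v → f (β ⊕ σ j , i , v)))) ⟩
    ∑ (cube ℓ) (λ β → ∑ (cube r) (λ i → ∑ (tables (cube r) r) (λ v → f (β ⊕ σ j , i , v))))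
      ≡⟨ ∑-cube-⊕ (σ j) (λ β → ∑ (cube r) (λ i → ∑ (tables (cube r) r) (λ v → f (β , i , v)))) ⟩
    ∑ (cube ℓ) (λ β → ∑ (cube r) (λ i → ∑ (tables (cube r) r) (λ v → f (β , i , v))))
      ≡⟨ ∑-symbols f ⟨
    ∑ symbols f ∎
    where open ≡-Reasoning

  Match : Symbol → Symbol → Fin r → Fin r → Set
  Match c c′ j j′ = j ≢ j′ × unact j c ≡ unact j′ c′

  unact-≢ : ∀ c {j j′} → j ≢ j′ → unact j c ≢ unact j′ c
  unact-≢ (β , t , v) j≢j′ eq = j≢j′ (unit-injective (⊕-cancelˡ t _ _ (cong (proj₁ ∘ proj₂) eq)))

  private
    tag : Symbol → Vec Bool r
    tag = proj₁ ∘ proj₂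

    DifferAt : Vec Bool r → Symbol → Symbol → Set
    DifferAt i (_ , _ , v) (_ , _ , v′) = look r i v ≢ look r i v′ × (∀ k → k ≢ i → look r k v ≡ look r k v′)

    match⇒differ : ∀ {c c′ j j′} → Match c c′ j j′ → DifferAt (tag c ⊕ unit j) c c′
    match⇒differ {β , t , v} {β′ , t′ , v′} {j} {j′} (j≢j′ , eq) = differ , agree
      where
      i = t ⊕ unit j
      i≡ : t ⊕ unit j ≡ t′ ⊕ unit j′
      i≡ = cong (proj₁ ∘ proj₂) eq
      tables≡ : adjust r i (_⊕ unit j) v ≡ adjust r i (_⊕ unit j′) v′
      tables≡ = trans (cong (proj₂ ∘ proj₂) eq) (cong (λ k → adjust r k (_⊕ unit j′) v′) (sym i≡))
      differ : look r i v ≢ look r i v′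
      differ same = j≢j′ (unit-injective (⊕-cancelˡ (look r i v) _ _ (begin
        look r i v ⊕ unit j                       ≡⟨ look-adjust r i (_⊕ unit j) v ⟨
        look r i (adjust r i (_⊕ unit j) v)       ≡⟨ cong (look r i) tables≡ ⟩
        look r i (adjust r i (_⊕ unit j′) v′)     ≡⟨ look-adjust r i (_⊕ unit j′) v′ ⟩
        look r i v′ ⊕ unit j′                     ≡⟨ cong (_⊕ unit j′) same ⟨
        look r i v ⊕ unit j′                      ∎)))
        where open ≡-Reasoning
      agree : ∀ k → k ≢ i → look r k v ≡ look r k v′
      agree k k≢i = trans (sym (look-adjust-≢ r (_⊕ unit j) v k≢i))
        (trans (cong (look r k) tables≡) (look-adjust-≢ r (_⊕ unit j′) v′ k≢i))

    _≟ᵛ_ : DecidableEquality (Vec Bool r)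
    _≟ᵛ_ = Vec.≡-dec Bool._≟_

    role-determined : ∀ c {j k} → tag c ⊕ unit j ≡ tag c ⊕ unit k → j ≡ k
    role-determined c eq = unit-injective (⊕-cancelˡ (tag c) _ _ eq)

    differ-unique : ∀ {i k} c c′ → DifferAt i c c′ → DifferAt k c c′ → i ≡ k
    differ-unique {i} {k} c c′ (d , _) (_ , a) with i ≟ᵛ k
    ... | yes i≡k = i≡k
    ... | no  i≢k = contradiction (a i i≢k) d

    -- If `i ≢ k`, then `l` misses one of them, say `i`. At `i`, both `c` and `c₁` agree with `c₂`,
    -- so `c` and `c₁` agree where they should differ.
    differ-triangle : ∀ {i k l} c c₁ c₂ → DifferAt i c c₁ → DifferAt k c c₂ → DifferAt l c₁ c₂ → i ≡ k
    differ-triangle {i} {k} {l} c c₁ c₂ (d₁ , a₁) (d₂ , a₂) (_ , a₁₂) with i ≟ᵛ k | i ≟ᵛ l | k ≟ᵛ l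
    ... | yes i≡k | _ | _ = i≡k
    ... | no i≢k | yes i≡l | yes k≡l = contradiction (trans i≡l (sym k≡l)) i≢k
    ... | no i≢k | no i≢l | _ = contradiction (trans (a₂ i i≢k) (sym (a₁₂ i i≢l))) d₁
    ... | no i≢k | yes _ | no k≢l = contradiction (trans (a₁ k (i≢k ∘ sym)) (a₁₂ k k≢l)) d₂

  match-role : ∀ c c′ {j j′ k k′} → Match c c′ j j′ → Match c c′ k k′ → j ≡ k
  match-role c c′ m m′ = role-determined c (differ-unique c c′ (match⇒differ m) (match⇒differ m′))

  match-sym : ∀ c c′ {j j′} → Match c c′ j j′ → Match c′ c j′ j
  match-sym c c′ (j≢j′ , eq) = j≢j′ ∘ sym , sym eq

  match-triangle : ∀ c c₁ c₂ {j j′ k k′ l l′} → Match c c₁ j j′ → Match c c₂ k k′ → Match c₁ c₂ l l′ → j ≡ k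
  match-triangle c c₁ c₂ m₁ m₂ m₁₂ =
    role-determined c (differ-triangle c c₁ c₂ (match⇒differ m₁) (match⇒differ m₂) (match⇒differ m₁₂))

  module Labelling {R : ℕ} (side : Fin R → Bool) (c : Fin R → Symbol) (j₀ : Fin r)
    (matches : ∀ i k → i ≢ k → side i ≡ side k → ∃₂ λ j j′ → Match (c i) (c k) j j′) where

    private
      partner? : ∀ i → Dec (∃ λ k → i ≢ k × side i ≡ side k)
      partner? i = Fin.any? (λ k → ¬? (i Fin.≟ k) ×-dec (side i Bool.≟ side k))

    label : Fin R → Fin r
    label i with partner? i
    ... | yes (k , i≢k , same) = proj₁ (matches i k i≢k same)
    -- A vertex alone on its side may take any role: only pairs on one side constrain the labels.
    ... | no  _                = j₀

    private
      -- Independence of the chosen partner: two partners `k` and `k′` of `i` lie on the same side,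
      -- hence match each other, and the triangle lemma forces one role for `i`.
      first : ∀ i k {j j′} → i ≢ k → side i ≡ side k → Match (c i) (c k) j j′ → j ≡ label i
      first i k i≢k same m with partner? i
      ... | no none = contradiction (k , i≢k , same) none
      ... | yes (k′ , i≢k′ , same′) with k Fin.≟ k′
      ...   | yes refl = match-role (c i) (c k) m (proj₂ (proj₂ (matches i k i≢k′ same′)))
      ...   | no k≢k′  = match-triangle (c i) (c k) (c k′) m (proj₂ (proj₂ (matches i k′ i≢k′ same′)))
                           (proj₂ (proj₂ (matches k k′ k≢k′ (trans (sym same) same′))))

    labelling : ∀ i k {j j′} → i ≢ k → side i ≡ side k → Match (c i) (c k) j j′ → j ≡ label i × j′ ≡ label k
    labelling i k i≢k same m = first i k i≢k same m ,
      first k i (i≢k ∘ sym) (sym same) (match-sym (c i) (c k) m)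

-- Vertex types, adjacency and cliques

weight≡∑ : ∀ {N} (x : Vec Bool N) → weight x ≡ ∑ (allFin N) (λ k → ⟦ lookup x k ⟧)
weight≡∑ []              = refl
weight≡∑ {suc N} (b ∷ x) = trans (cong (⟦ b ⟧ +_) (weight≡∑ x)) (sym (∑-allFin-suc N (λ k → ⟦ lookup (b ∷ x) k ⟧)))

lookup-≢ : ∀ {n} {x y : Vec Bool n} → x ≢ y → ∃ λ b → lookup x b ≢ lookup y b
lookup-≢ {x = x} {y} x≢y with Fin.any? (λ b → ¬? (lookup x b Bool.≟ lookup y b))
... | yes found = found
... | no  none  = contradiction (trans (sym (Vec.tabulate∘lookup x)) (trans
  (Vec.tabulate-cong (λ b → decidable-stable (lookup x b Bool.≟ lookup y b) (λ ≢ → none (b , ≢))))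
  (Vec.tabulate∘lookup y))) x≢y

-- A vertex type (u , γ) carries ℓ binary words u of length 2h and a word γ of symbols. Two types
-- on the same side are joined when the words of symbols are obtained, up to τ errors, from a
-- common word by two different roles. Types x and y on opposite sides are joined when, for each
-- colour bit, the colours of x and y disagree in fewer than h − a of the 2h places, where place k
-- compares the positions E k of x and y, with y's colour flipped by its own word u.
module Construction (r ℓ : ℕ) (σ : Fin r → Vec Bool ℓ) (n τ a h : ℕ) (E : Vec (Fin n × Fin n) (h + h)) where

  open Alphabet r ℓ σ public
  open Hamming _≟ˢ_ public

  Word : Set
  Word = Vec Symbol n

  VertexType : Set
  VertexType = Vec (Vec Bool (h + h)) ℓ × Word

  strip : Fin r → Word → Word
  strip j = Vec.map (unact j)

  Linked : Word → Word → Fin r → Fin r → Set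
  Linked γ γ′ j j′ = j ≢ j′ × hamming (strip j γ) (strip j′ γ′) ≤ τ

  -- The words `u` must agree so that, in a four-cycle across the halves, all four comparisons are
  -- flipped by the same word.
  Inner : VertexType → VertexType → Set
  Inner (u , γ) (u′ , γ′) = u ≡ u′ × ∃₂ (Linked γ γ′)

  Inner? : ∀ x y → Dec (Inner x y)
  Inner? (u , γ) (u′ , γ′) = Vec.≡-dec (Vec.≡-dec Bool._≟_) u u′ ×-dec
    Fin.any? (λ j → Fin.any? (λ j′ → ¬? (j Fin.≟ j′) ×-dec (hamming (strip j γ) (strip j′ γ′) ≤? τ)))

  Inner-sym : ∀ x y → Inner x y → Inner y x
  Inner-sym (u , γ) (u′ , γ′) (u≡ , j , j′ , j≢j′ , close) =
    sym u≡ , j′ , j , j≢j′ ∘ sym , subst (_≤ τ) (hamming-sym (strip j γ) (strip j′ γ′)) close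

  -- Excludes loops: two roles recover different indices from the same tag, so no letter survives as
  -- a coincidence.
  hamming-strip : ∀ {m} (γ : Vec Symbol m) {j j′} → j ≢ j′ → hamming (Vec.map (unact j) γ) (Vec.map (unact j′) γ) ≡ m
  hamming-strip []      _    = refl
  hamming-strip (c ∷ γ) j≢j′ = cong₂ _+_ (mismatch-≢ (unact-≢ c j≢j′)) (hamming-strip γ j≢j′)

  Inner-irrefl : τ < n → ∀ x → ¬ Inner x x
  Inner-irrefl τ<n (u , γ) (_ , j , j′ , j≢j′ , close) = <⇒≱ τ<n (subst (_≤ τ) (hamming-strip γ j≢j′) close)

  colourBit : Fin ℓ → Word → Fin n → Bool
  colourBit b γ κ = lookup (colour (lookup γ κ)) b

  comparison : Word → Word → Fin ℓ → Vec Bool (h + h)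
  comparison γ γ′ b = Vec.tabulate (λ k → colourBit b γ (proj₁ (lookup E k)) xor colourBit b γ′ (proj₂ (lookup E k)))

  allLight : ∀ {l} → (Fin l → Vec Bool (h + h)) → Vec (Vec Bool (h + h)) l → Bool
  allLight p []      = true
  allLight p (w ∷ u) = light a h (w ⊕ p zero) ∧ allLight (p ∘ suc) u

  allLight⇒light : ∀ {l} p (u : Vec (Vec Bool (h + h)) l) → allLight p u ≡ true → ∀ b → light a h (lookup u b ⊕ p b) ≡ true
  allLight⇒light p (w ∷ u) eq zero    = proj₁ (∧-true⁻ eq)
  allLight⇒light p (w ∷ u) eq (suc b) = allLight⇒light (p ∘ suc) u (proj₂ (∧-true⁻ {light a h (w ⊕ p zero)} eq)) b

  -- Adding the fixed comparison permutes the cube, so the count over `u` alone is an exact product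
  -- over the colour bits, the same for every pair of symbol words.
  ∑-allLight : ∀ {l} p → ∑ (words (cube (h + h)) l) (⟦_⟧ ∘ allLight p) ≡ lights a h ^ l
  ∑-allLight {zero}  p = refl
  ∑-allLight {suc l} p = begin
    ∑ (words (cube (h + h)) (suc l)) (⟦_⟧ ∘ allLight p)
      ≡⟨ ∑-words-suc (cube (h + h)) l (⟦_⟧ ∘ allLight p) ⟩
    ∑ (cube (h + h)) (λ w → ∑ (words (cube (h + h)) l) (λ u → ⟦ light a h (w ⊕ p zero) ∧ allLight (p ∘ suc) u ⟧))
      ≡⟨ ∑-cong (cube (h + h)) (λ w → trans (∑-cong (words (cube (h + h)) l) (λ u → ⟦∧⟧ (light a h (w ⊕ p zero)) (allLight (p ∘ suc) u)))
           (∑-*ˡ (words (cube (h + h)) l) ⟦ light a h (w ⊕ p zero) ⟧ (⟦_⟧ ∘ allLight (p ∘ suc)))) ⟩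
    ∑ (cube (h + h)) (λ w → ⟦ light a h (w ⊕ p zero) ⟧ * ∑ (words (cube (h + h)) l) (⟦_⟧ ∘ allLight (p ∘ suc)))
      ≡⟨ ∑-*ʳ (cube (h + h)) _ (λ w → ⟦ light a h (w ⊕ p zero) ⟧) ⟩
    ∑ (cube (h + h)) (λ w → ⟦ light a h (w ⊕ p zero) ⟧) * ∑ (words (cube (h + h)) l) (⟦_⟧ ∘ allLight (p ∘ suc))
      ≡⟨ cong₂ _*_ (∑-cube-⊕ (p zero) (⟦_⟧ ∘ light a h)) (∑-allLight (p ∘ suc)) ⟩
    lights a h * lights a h ^ l ∎
    where open ≡-Reasoning

  cross : VertexType → VertexType → Bool
  cross (_ , γ) (u′ , γ′) = allLight (comparison γ γ′) u′

  Vertex : Set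
  Vertex = Bool × VertexType

  Adj : Vertex → Vertex → Set
  Adj (true  , x) (true  , y) = Inner x y
  Adj (false , x) (false , y) = Inner x y
  Adj (true  , x) (false , y) = cross x y ≡ true
  Adj (false , x) (true  , y) = cross y x ≡ true

  Adj? : ∀ v w → Dec (Adj v w)
  Adj? (true  , x) (true  , y) = Inner? x y
  Adj? (false , x) (false , y) = Inner? x y
  Adj? (true  , x) (false , y) = cross x y Bool.≟ true
  Adj? (false , x) (true  , y) = cross y x Bool.≟ true

  Adj-sym : ∀ v w → Adj v w → Adj w v
  Adj-sym (true  , x) (true  , y) = Inner-sym x y
  Adj-sym (false , x) (false , y) = Inner-sym x y
  Adj-sym (true  , x) (false , y) = id
  Adj-sym (false , x) (true  , y) = id

  Adj-irrefl : τ < n → ∀ v → ¬ Adj v v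
  Adj-irrefl τ<n (true  , x) = Inner-irrefl τ<n x
  Adj-irrefl τ<n (false , x) = Inner-irrefl τ<n x

  Adj-same-side : ∀ v w → proj₁ v ≡ proj₁ w → Adj v w → Inner (proj₂ v) (proj₂ w)
  Adj-same-side (true  , x) (true  , y) refl adj = adj
  Adj-same-side (false , x) (false , y) refl adj = adj

  Adj-across : ∀ v w → proj₁ v ≡ true → proj₁ w ≡ false → Adj v w → cross (proj₂ v) (proj₂ w) ≡ true
  Adj-across (true , x) (false , y) refl refl adj = adj

  module _ (sparse : ∀ (p p′ : Fin n → Bool) → ∑ (allFin n) (⟦_⟧ ∘ p) ≤ τ → ∑ (allFin n) (⟦_⟧ ∘ p′) ≤ τ →
                     ∑ (allFin (h + h)) (λ k → ⟦ p (proj₁ (lookup E k)) ∧ p′ (proj₂ (lookup E k)) ⟧) ≤ a) where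

    private
      mismatched : Word → Word → Fin r → Fin r → Fin n → Bool
      mismatched γ γ′ j j′ κ = not (does (unact j (lookup γ κ) ≟ˢ unact j′ (lookup γ′ κ)))

      ∑-mismatched : ∀ γ γ′ j j′ → ∑ (allFin n) (⟦_⟧ ∘ mismatched γ γ′ j j′) ≡ hamming (strip j γ) (strip j′ γ′)
      ∑-mismatched γ γ′ j j′ = sym (trans (hamming≡∑ (strip j γ) (strip j′ γ′))
        (∑-cong (allFin n) (λ κ → cong₂ mismatch (Vec.lookup-map κ (unact j) γ) (Vec.lookup-map κ (unact j′) γ′))))

      opposite-bits : ∀ γ γ′ j j′ b κ → lookup (σ j) b ≢ lookup (σ j′) b → mismatched γ γ′ j j′ κ ≡ false →
                      colourBit b γ′ κ ≡ not (colourBit b γ κ)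
      opposite-bits γ γ′ j j′ b κ s≢s′ matched with unact j (lookup γ κ) ≟ˢ unact j′ (lookup γ′ κ)
      ... | yes eq = flip (colourBit b γ κ) (colourBit b γ′ κ) (lookup (σ j) b) (lookup (σ j′) b) s≢s′
        (trans (sym (Vec.lookup-zipWith _xor_ b (colour (lookup γ κ)) (σ j)))
          (trans (cong (λ c → lookup (colour c) b) eq) (Vec.lookup-zipWith _xor_ b (colour (lookup γ′ κ)) (σ j′))))
        where
        flip : ∀ c c′ s s′ → s ≢ s′ → c xor s ≡ c′ xor s′ → c′ ≡ not c
        flip c     c′    true  true  s≢s′ _ = contradiction refl s≢s′
        flip c     c′    false false s≢s′ _ = contradiction refl s≢s′
        flip true  false true  false _ _ = refl
        flip false true  true  false _ _ = refl
        flip true  false false true  _ _ = refl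
        flip false true  false true  _ _ = refl

      -- If the two bits at one endpoint are complementary, the four values form two complementary
      -- pairs and sum to 2. The correction is due only when both endpoints are in error, which is
      -- what reduces the loss to edges between two small sets.
      parity : ∀ x₁ x₂ y₁ y₂ u p p′ → (p ≡ false → x₂ ≡ not x₁) → (p′ ≡ false → y₂ ≡ not y₁) →
        2 ≤ ⟦ u xor (x₁ xor y₁) ⟧ + ⟦ u xor (x₁ xor y₂) ⟧ + (⟦ u xor (x₂ xor y₁) ⟧ + ⟦ u xor (x₂ xor y₂) ⟧) + 2 * ⟦ p ∧ p′ ⟧
      parity x₁ x₂ y₁ y₂ u true true _ _ = m≤n+m 2 _
      parity x₁ x₂ y₁ y₂ u false p′ eq _ rewrite eq refl = go x₁ y₁ y₂ u
        where
        go : ∀ x₁ y₁ y₂ u → 2 ≤ ⟦ u xor (x₁ xor y₁) ⟧ + ⟦ u xor (x₁ xor y₂) ⟧ + (⟦ u xor (not x₁ xor y₁) ⟧ + ⟦ u xor (not x₁ xor y₂) ⟧) + 2 * 0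
        go true true true true = s≤s (s≤s z≤n)
        go true true true false = s≤s (s≤s z≤n)
        go true true false true = s≤s (s≤s z≤n)
        go true true false false = s≤s (s≤s z≤n)
        go true false true true = s≤s (s≤s z≤n)
        go true false true false = s≤s (s≤s z≤n)
        go true false false true = s≤s (s≤s z≤n)
        go true false false false = s≤s (s≤s z≤n)
        go false true true true = s≤s (s≤s z≤n)
        go false true true false = s≤s (s≤s z≤n)
        go false true false true = s≤s (s≤s z≤n)
        go false true false false = s≤s (s≤s z≤n)
        go false false true true = s≤s (s≤s z≤n)
        go false false true false = s≤s (s≤s z≤n)
        go false false false true = s≤s (s≤s z≤n)
        go false false false false = s≤s (s≤s z≤n)
      parity x₁ x₂ y₁ y₂ u true false _ eq rewrite eq refl = go x₁ x₂ y₁ u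
        where
        go : ∀ x₁ x₂ y₁ u → 2 ≤ ⟦ u xor (x₁ xor y₁) ⟧ + ⟦ u xor (x₁ xor not y₁) ⟧ + (⟦ u xor (x₂ xor y₁) ⟧ + ⟦ u xor (x₂ xor not y₁) ⟧) + 2 * 0
        go true true true true = s≤s (s≤s z≤n)
        go true true true false = s≤s (s≤s z≤n)
        go true true false true = s≤s (s≤s z≤n)
        go true true false false = s≤s (s≤s z≤n)
        go true false true true = s≤s (s≤s z≤n)
        go true false true false = s≤s (s≤s z≤n)
        go true false false true = s≤s (s≤s z≤n)
        go true false false false = s≤s (s≤s z≤n)
        go false true true true = s≤s (s≤s z≤n)
        go false true true false = s≤s (s≤s z≤n)
        go false true false true = s≤s (s≤s z≤n)
        go false true false false = s≤s (s≤s z≤n)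
        go false false true true = s≤s (s≤s z≤n)
        go false false true false = s≤s (s≤s z≤n)
        go false false false true = s≤s (s≤s z≤n)
        go false false false false = s≤s (s≤s z≤n)

    -- If roles j and j′ have colours differing in bit b, then bit b of γ₂ (of δ₂) is opposite to
    -- that of γ₁ (of δ₁) up to τ errors, so the four comparisons together have weight at least
    -- 2 (2h − a): they cannot all be light.
    no-four-cycle : ∀ u γ₁ γ₂ δ₁ δ₂ {j j′} → Linked γ₁ γ₂ j j′ → Linked δ₁ δ₂ j j′ → σ j ≢ σ j′ →
      (∀ {γ δ} → γ ≡ γ₁ ⊎ γ ≡ γ₂ → δ ≡ δ₁ ⊎ δ ≡ δ₂ → allLight (comparison γ δ) u ≡ true) → ⊥
    no-four-cycle u γ₁ γ₂ δ₁ δ₂ {j} {j′} (_ , closeγ) (_ , closeδ) σ≢ lit with lookup-≢ σ≢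
    ... | b , s≢s′ = <⇒≱ (m<m+n (2 * (h + h)) {4} (s≤s z≤n)) (+-cancelʳ-≤ (4 * a) _ _ (begin
      2 * (h + h) + 4 + 4 * a
        ≤⟨ +-monoˡ-≤ (4 * a) (+-monoˡ-≤ 4 total) ⟩
      W₁₁ + W₁₂ + (W₂₁ + W₂₂) + 2 * a + 4 + 4 * a
        ≡⟨ e₁ W₁₁ W₁₂ W₂₁ W₂₂ a ⟩
      (suc (W₁₁ + a) + suc (W₁₂ + a)) + (suc (W₂₁ + a) + suc (W₂₂ + a)) + 2 * a
        ≤⟨ +-monoˡ-≤ (2 * a) (+-mono-≤ (+-mono-≤ (small (inj₁ refl) (inj₁ refl)) (small (inj₁ refl) (inj₂ refl)))
                                       (+-mono-≤ (small (inj₂ refl) (inj₁ refl)) (small (inj₂ refl) (inj₂ refl)))) ⟩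
      h + h + (h + h) + 2 * a
        ≤⟨ +-mono-≤ (≤-reflexive (e₂ h)) (*-monoˡ-≤ a {2} {4} (s≤s (s≤s z≤n))) ⟩
      2 * (h + h) + 4 * a ∎))
      where
      open ≤-Reasoning
      N = h + h
      place : Word → Word → Fin N → Bool
      place γ δ k = lookup (lookup u b) k xor (colourBit b γ (proj₁ (lookup E k)) xor colourBit b δ (proj₂ (lookup E k)))
      W : Word → Word → ℕ
      W γ δ = weight (lookup u b ⊕ comparison γ δ b)
      W₁₁ = W γ₁ δ₁
      W₁₂ = W γ₁ δ₂
      W₂₁ = W γ₂ δ₁
      W₂₂ = W γ₂ δ₂
      W≡∑ : ∀ γ δ → W γ δ ≡ ∑ (allFin N) (λ k → ⟦ place γ δ k ⟧)
      W≡∑ γ δ = trans (weight≡∑ (lookup u b ⊕ comparison γ δ b)) (∑-cong (allFin N) (λ k → cong ⟦_⟧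
        (trans (Vec.lookup-zipWith _xor_ k (lookup u b) (comparison γ δ b)) (cong (lookup (lookup u b) k xor_) (Vec.lookup∘tabulate _ k)))))
      small : ∀ {γ δ} → γ ≡ γ₁ ⊎ γ ≡ γ₂ → δ ≡ δ₁ ⊎ δ ≡ δ₂ → suc (W γ δ + a) ≤ h
      small {γ} {δ} γ∈ δ∈ = <ᵇ⇒< (W γ δ + a) h (subst T (sym (allLight⇒light (comparison γ δ) u (lit γ∈ δ∈) b)) _)
      p = mismatched γ₁ γ₂ j j′
      p′ = mismatched δ₁ δ₂ j j′
      e₁ : ∀ w x y z a → w + x + (y + z) + 2 * a + 4 + 4 * a ≡ ((1 + (w + a)) + (1 + (x + a))) + ((1 + (y + a)) + (1 + (z + a))) + 2 * a
      e₁ = solve-∀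
      e₂ : ∀ h → h + h + (h + h) ≡ 2 * (h + h)
      e₂ = solve-∀
      total : 2 * N ≤ W₁₁ + W₁₂ + (W₂₁ + W₂₂) + 2 * a
      total = begin
        2 * N
          ≡⟨ trans (*-comm 2 N) (sym (trans (∑-const (allFin N) 2) (cong (_* 2) (length-tabulate {n = N} id)))) ⟩
        ∑ (allFin N) (λ _ → 2)
          ≤⟨ ∑-mono (allFin N) (λ k → parity (colourBit b γ₁ (proj₁ (lookup E k))) (colourBit b γ₂ (proj₁ (lookup E k)))
               (colourBit b δ₁ (proj₂ (lookup E k))) (colourBit b δ₂ (proj₂ (lookup E k))) (lookup (lookup u b) k)
               (p (proj₁ (lookup E k))) (p′ (proj₂ (lookup E k)))
               (opposite-bits γ₁ γ₂ j j′ b (proj₁ (lookup E k)) s≢s′) (opposite-bits δ₁ δ₂ j j′ b (proj₂ (lookup E k)) s≢s′)) ⟩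
        ∑ (allFin N) (λ k → ⟦ place γ₁ δ₁ k ⟧ + ⟦ place γ₁ δ₂ k ⟧ + (⟦ place γ₂ δ₁ k ⟧ + ⟦ place γ₂ δ₂ k ⟧) + 2 * ⟦ p (proj₁ (lookup E k)) ∧ p′ (proj₂ (lookup E k)) ⟧)
          ≡⟨ trans (∑-+ (allFin N) _ _) (cong₂ _+_
               (trans (∑-+ (allFin N) _ _) (cong₂ _+_ (∑-+ (allFin N) _ _) (∑-+ (allFin N) _ _))) (∑-*ˡ (allFin N) 2 _)) ⟩
        ∑ (allFin N) (λ k → ⟦ place γ₁ δ₁ k ⟧) + ∑ (allFin N) (λ k → ⟦ place γ₁ δ₂ k ⟧) + (∑ (allFin N) (λ k → ⟦ place γ₂ δ₁ k ⟧) + ∑ (allFin N) (λ k → ⟦ place γ₂ δ₂ k ⟧))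
          + 2 * ∑ (allFin N) (λ k → ⟦ p (proj₁ (lookup E k)) ∧ p′ (proj₂ (lookup E k)) ⟧)
          ≤⟨ +-mono-≤ (≤-reflexive (sym (cong₂ _+_ (cong₂ _+_ (W≡∑ γ₁ δ₁) (W≡∑ γ₁ δ₂)) (cong₂ _+_ (W≡∑ γ₂ δ₁) (W≡∑ γ₂ δ₂)))))
               (*-monoʳ-≤ 2 (sparse p p′ (subst (_≤ τ) (sym (∑-mismatched γ₁ γ₂ j j′)) closeγ) (subst (_≤ τ) (sym (∑-mismatched δ₁ δ₂ j j′)) closeδ))) ⟩
        W₁₁ + W₁₂ + (W₂₁ + W₂₂) + 2 * a ∎

    module Clique {q : ℕ} (quot : Fin r → Fin q) (σ,quot-injective : ∀ {j k} → σ j ≡ σ k → quot j ≡ quot k → j ≡ k)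
      {R : ℕ} (j₀ : Fin r) (f : Fin R → Vertex) (adjacent : ∀ i k → i ≢ k → Adj (f i) (f k)) (room : R * (R * τ) < n) where

      private
        side : Fin R → Bool
        side i = proj₁ (f i)

        word : Fin R → Word
        word i = proj₂ (proj₂ (f i))

        inner : ∀ i k → i ≢ k → side i ≡ side k → Inner (proj₂ (f i)) (proj₂ (f k))
        inner i k i≢k same = Adj-same-side (f i) (f k) same (adjacent i k i≢k)

        -- The roles are those returned by `Inner?`, so that a vanishing error refers to the very
        -- roles that `error-free` extracts.
        errors : Fin R → Fin R → Fin n → ℕ
        errors i k κ with Inner? (proj₂ (f i)) (proj₂ (f k))
        ... | yes (_ , j , j′ , _) = ⟦ mismatched (word i) (word k) j j′ κ ⟧
        ... | no  _                = 0

        ∑-errors : ∀ i k → ∑ (allFin n) (errors i k) ≤ τ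
        ∑-errors i k with Inner? (proj₂ (f i)) (proj₂ (f k))
        ... | yes (_ , j , j′ , _ , close) = subst (_≤ τ) (sym (∑-mismatched (word i) (word k) j j′)) close
        ... | no  _ = ≤-trans (≤-reflexive (trans (∑-const (allFin n) 0) (*-zeroʳ (length (allFin n))))) z≤n

        error-free : ∀ i k κ → Inner (proj₂ (f i)) (proj₂ (f k)) → errors i k κ ≡ 0 →
                     ∃₂ λ j j′ → Match (lookup (word i) κ) (lookup (word k) κ) j j′ × Linked (word i) (word k) j j′
        error-free i k κ in′ none with Inner? (proj₂ (f i)) (proj₂ (f k))
        ... | yes (_ , j , j′ , j≢j′ , close) = j , j′ , (j≢j′ , mismatch≡0⇒≡ _ _ none) , (j≢j′ , close)
        ... | no  ¬in = contradiction in′ ¬in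

        -- The `R²` pairs produce at most `R²τ < n` errors together, so some position is free of
        -- errors for all pairs at once; its symbols fix the roles.
        generic : ∃ λ κ → ∑ (allFin R) (λ i → ∑ (allFin R) (λ k → errors i k κ)) ≡ 0
        generic = ∑-<length⇒∃≡0 (allFin n) (begin-strict
          ∑ (allFin n) (λ κ → ∑ (allFin R) (λ i → ∑ (allFin R) (λ k → errors i k κ)))
            ≡⟨ ∑-swap (allFin n) (allFin R) (λ κ i → ∑ (allFin R) (λ k → errors i k κ)) ⟩
          ∑ (allFin R) (λ i → ∑ (allFin n) (λ κ → ∑ (allFin R) (λ k → errors i k κ)))
            ≡⟨ ∑-cong (allFin R) (λ i → ∑-swap (allFin n) (allFin R) (λ κ k → errors i k κ)) ⟩
          ∑ (allFin R) (λ i → ∑ (allFin R) (λ k → ∑ (allFin n) (errors i k)))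
            ≤⟨ ∑-mono (allFin R) (λ i → ∑-mono (allFin R) (λ k → ∑-errors i k)) ⟩
          ∑ (allFin R) (λ i → ∑ (allFin R) (λ k → τ))
            ≡⟨ trans (∑-cong (allFin R) (λ _ → ∑-const (allFin R) τ)) (trans (∑-const (allFin R) _) (cong (λ l → l * (l * τ)) (length-tabulate {n = R} id))) ⟩
          R * (R * τ)
            <⟨ room ⟩
          n
            ≡⟨ length-tabulate {n = n} id ⟨
          length (allFin n) ∎)
          where open ≤-Reasoning

        module Coded (label : Fin R → Fin r)
          (linked : ∀ i k → i ≢ k → side i ≡ side k → Linked (word i) (word k) (label i) (label k)) where

          Shared : Fin R → Set
          Shared i = ∃ λ k → side k ≡ true × label k ≡ label i

          Shared? : ∀ i → Dec (Shared i)
          Shared? i = Fin.any? (λ k → (side k Bool.≟ true) ×-dec (label k Fin.≟ label i))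

          -- A `false` vertex whose role recurs on the `true` side is recorded by its remainder,
          -- every other vertex by its role. Two recurring roles with equal remainders would have
          -- different colours, and the four vertices carrying them would contradict
          -- `no-four-cycle`.
          code : Fin R → Fin r ⊎ Fin q
          code i with side i Bool.≟ true | Shared? i
          ... | yes _ | _     = inj₁ (label i)
          ... | no  _ | yes _ = inj₂ (quot (label i))
          ... | no  _ | no  _ = inj₁ (label i)

          same-side-label-≢ : ∀ i k → i ≢ k → side i ≡ side k → label i ≢ label k
          same-side-label-≢ i k i≢k same = proj₁ (linked i k i≢k same)

          code-injective : ∀ i k → code i ≡ code k → i ≡ k
          code-injective i k eq with i Fin.≟ k
          ... | yes i≡k = i≡k
          ... | no  i≢k with side i Bool.≟ true | Shared? i | side k Bool.≟ true | Shared? k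
          ...   | yes x | _ | yes x′ | _ = contradiction (inj₁-injective eq) (same-side-label-≢ i k i≢k (trans x (sym x′)))
          ...   | yes x | _ | no y | no unshared = contradiction (i , x , inj₁-injective eq) unshared
          ...   | no y | no unshared | yes x | _ = contradiction (k , x , sym (inj₁-injective eq)) unshared
          ...   | no y | no _ | no y′ | no _ = contradiction (inj₁-injective eq) (same-side-label-≢ i k i≢k (trans (Bool.¬-not y) (sym (Bool.¬-not y′))))
          ...   | no y | yes (i′ , xi , li) | no y′ | yes (k′ , xk , lk) = contradiction impossible λ ()
            where
            same : side i ≡ side k
            same = trans (Bool.¬-not y) (sym (Bool.¬-not y′))
            label≢ : label i ≢ label k
            label≢ = same-side-label-≢ i k i≢k same
            i′≢k′ : i′ ≢ k′
            i′≢k′ refl = label≢ (trans (sym li) lk)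
            u≡ : proj₁ (proj₂ (f i)) ≡ proj₁ (proj₂ (f k))
            u≡ = proj₁ (inner i k i≢k same)
            lit′ : ∀ x y → side x ≡ true → side y ≡ false → proj₁ (proj₂ (f y)) ≡ proj₁ (proj₂ (f i)) →
                   allLight (comparison (word x) (word y)) (proj₁ (proj₂ (f i))) ≡ true
            lit′ x y sx sy eq = subst (λ u → allLight (comparison (word x) (word y)) u ≡ true) eq
              (Adj-across (f x) (f y) sx sy (adjacent x y λ { refl → contradiction (trans (sym sx) sy) λ () }))
            lit : ∀ {γ δ} → γ ≡ word i′ ⊎ γ ≡ word k′ → δ ≡ word i ⊎ δ ≡ word k → allLight (comparison γ δ) (proj₁ (proj₂ (f i))) ≡ true
            lit (inj₁ refl) (inj₁ refl) = lit′ i′ i xi (Bool.¬-not y) refl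
            lit (inj₁ refl) (inj₂ refl) = lit′ i′ k xi (Bool.¬-not y′) (sym u≡)
            lit (inj₂ refl) (inj₁ refl) = lit′ k′ i xk (Bool.¬-not y) refl
            lit (inj₂ refl) (inj₂ refl) = lit′ k′ k xk (Bool.¬-not y′) (sym u≡)
            impossible : ⊥
            impossible = no-four-cycle (proj₁ (proj₂ (f i))) (word i′) (word k′) (word i) (word k) {label i} {label k}
              (subst (λ j → Linked (word i′) (word k′) j (label k)) li (subst (Linked (word i′) (word k′) (label i′)) lk (linked i′ k′ i′≢k′ (trans xi (sym xk)))))
              (linked i k i≢k same)
              (λ σ≡ → label≢ (σ,quot-injective σ≡ (inj₂-injective eq)))
              lit

          coded-bound : R ≤ r + q
          coded-bound = ≮⇒≥ λ r+q<R → collision (Fin.pigeonhole r+q<R (join r q ∘ code))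
            where
            collision : (∃₂ λ i k → i <ᶠ k × join r q (code i) ≡ join r q (code k)) → ⊥
            collision (i , k , i<k , eq) = Fin.<⇒≢ i<k (code-injective i k
              (trans (sym (Fin.splitAt-join r q (code i))) (trans (cong (splitAt r) eq) (Fin.splitAt-join r q (code k)))))

        module AtPosition (κ₀ : Fin n) (error≡0 : ∀ i k → errors i k κ₀ ≡ 0) where

          matched : ∀ i k → i ≢ k → side i ≡ side k →
                    ∃₂ λ j j′ → Match (lookup (word i) κ₀) (lookup (word k) κ₀) j j′ × Linked (word i) (word k) j j′
          matched i k i≢k same = error-free i k κ₀ (inner i k i≢k same) (error≡0 i k)

          matches : ∀ i k → i ≢ k → side i ≡ side k → ∃₂ (Match (lookup (word i) κ₀) (lookup (word k) κ₀))
          matches i k i≢k same with matched i k i≢k same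
          ... | j , j′ , m , _ = j , j′ , m

          open Labelling side (λ i → lookup (word i) κ₀) j₀ matches

          linked : ∀ i k → i ≢ k → side i ≡ side k → Linked (word i) (word k) (label i) (label k)
          linked i k i≢k same with matched i k i≢k same
          ... | j , j′ , m , l = subst (λ j → Linked (word i) (word k) j (label k)) (proj₁ roles)
                                   (subst (Linked (word i) (word k) j) (proj₂ roles) l)
            where
            roles : j ≡ label i × j′ ≡ label k
            roles = labelling i k i≢k same m

          open Coded label linked public using (coded-bound)

      clique-bound : R ≤ r + q
      clique-bound = conclude generic
        where
        conclude : (∃ λ κ → ∑ (allFin R) (λ i → ∑ (allFin R) (λ k → errors i k κ)) ≡ 0) → R ≤ r + q
        conclude (κ , none) = AtPosition.coded-bound κ λ i k →
          ∑≡0⇒≡0-Fin (λ k → errors i k κ) (∑≡0⇒≡0-Fin (λ i → ∑ (allFin R) (λ k → errors i k κ)) none i) k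

-- Blow-ups and edge counts

∑-words-map : ∀ {as : List A} {f : A → A} → (∀ g → ∑ as (g ∘ f) ≡ ∑ as g) →
              ∀ N (g : Vec A N → ℕ) → ∑ (words as N) (g ∘ Vec.map f) ≡ ∑ (words as N) g
∑-words-map inv zero    g = refl
∑-words-map {as = as} {f} inv (suc N) g = begin
  ∑ (words as (suc N)) (g ∘ Vec.map f)
    ≡⟨ ∑-words-suc as N (g ∘ Vec.map f) ⟩
  ∑ as (λ a → ∑ (words as N) (λ x → g (f a ∷ Vec.map f x)))
    ≡⟨ ∑-cong as (λ a → ∑-words-map inv N (λ x → g (f a ∷ x))) ⟩
  ∑ as (λ a → ∑ (words as N) (λ x → g (f a ∷ x)))
    ≡⟨ inv (λ a → ∑ (words as N) (λ x → g (a ∷ x))) ⟩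
  ∑ as (λ a → ∑ (words as N) (λ x → g (a ∷ x)))
    ≡⟨ ∑-words-suc as N g ⟨
  ∑ (words as (suc N)) g ∎
  where open ≡-Reasoning

∈⇒0<length : ∀ {x : A} {xs} → x ∈ xs → 0 < length xs
∈⇒0<length (here _)  = s≤s z≤n
∈⇒0<length (there _) = s≤s z≤n

fill : ∀ {D : Set} b → D → Table D b
fill zero    d = d
fill (suc b) d = fill b d , fill b d

-- The `ρ` extra copies of `v₀` fill up to an arbitrary number of vertices. Copies of one vertex
-- will be non-adjacent, since `Adj` is irreflexive.
blowUp : List A → A → ℕ → ℕ → List A
blowUp vs v₀ zero    ρ = List.replicate ρ v₀
blowUp vs v₀ (suc t) ρ = vs ++ blowUp vs v₀ t ρ

∑-blowUp : ∀ (vs : List A) v₀ t ρ (g : A → ℕ) → ∑ (blowUp vs v₀ t ρ) g ≡ t * ∑ vs g + ρ * g v₀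
∑-blowUp vs v₀ zero    zero    g = refl
∑-blowUp vs v₀ zero    (suc ρ) g = cong (g v₀ +_) (∑-blowUp vs v₀ zero ρ g)
∑-blowUp vs v₀ (suc t) ρ       g = trans (∑-++ vs (blowUp vs v₀ t ρ) g)
  (trans (cong (∑ vs g +_) (∑-blowUp vs v₀ t ρ g)) (sym (+-assoc (∑ vs g) (t * ∑ vs g) (ρ * g v₀))))

∑-lookup : ∀ (xs : List A) (g : A → ℕ) → ∑ (allFin (length xs)) (g ∘ List.lookup xs) ≡ ∑ xs g
∑-lookup []       g = refl
∑-lookup (x ∷ xs) g = trans (∑-allFin-suc (length xs) (g ∘ List.lookup (x ∷ xs))) (cong (g x +_) (∑-lookup xs g))

blow-up-map : ∀ (vs : List A) v₀ t ρ {ν} → ν ≡ ρ + t * length vs →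
  ∃ λ (f : Fin ν → A) → ∀ g → ∑ (allFin ν) (g ∘ f) ≡ t * ∑ vs g + ρ * g v₀
blow-up-map {A} vs v₀ t ρ {ν} eq = enumerate ν (trans eq (sym length≡))
  where
  open ≡-Reasoning
  xs = blowUp vs v₀ t ρ
  length≡ : length xs ≡ ρ + t * length vs
  length≡ = begin
    length xs                         ≡⟨ ∑-length xs ⟨
    ∑ xs (λ _ → 1)                    ≡⟨ ∑-blowUp vs v₀ t ρ (λ _ → 1) ⟩
    t * ∑ vs (λ _ → 1) + ρ * 1        ≡⟨ cong₂ _+_ (cong (t *_) (∑-length vs)) (*-identityʳ ρ) ⟩
    t * length vs + ρ                 ≡⟨ +-comm (t * length vs) ρ ⟩
    ρ + t * length vs                 ∎
  enumerate : ∀ ν → ν ≡ length xs → ∃ λ (f : Fin ν → A) → ∀ g → ∑ (allFin ν) (g ∘ f) ≡ t * ∑ vs g + ρ * g v₀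
  enumerate _ refl = List.lookup xs , λ g → trans (∑-lookup xs g) (∑-blowUp vs v₀ t ρ g)

∣∣≡∑ : ∀ {n} (S : Subset n) → ∣ S ∣ ≡ ∑ (allFin n) (λ i → ⟦ lookup S i ⟧)
∣∣≡∑ []                  = refl
∣∣≡∑ {suc n} (true ∷ S)  = trans (cong suc (∣∣≡∑ S)) (sym (∑-allFin-suc n (λ i → ⟦ lookup (true ∷ S) i ⟧)))
∣∣≡∑ {suc n} (false ∷ S) = trans (∣∣≡∑ S) (sym (∑-allFin-suc n (λ i → ⟦ lookup (false ∷ S) i ⟧)))

edgeCount≡∑ : ∀ {n} (G : Graph n) →
  edgeCount G ≡ ∑ (allFin n) (λ i → ∑ (allFin n) (λ k → ⟦ (toℕ i <ᵇ toℕ k) ∧ adj G i k ⟧))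
edgeCount≡∑ {n} G = trans (sym (∑≡sum (cartesianProduct (allFin n) (allFin n)) _))
  (∑-cartesianProductWith _,_ (allFin n) (allFin n) _)

-- An ordered pair running against the order of the indices is reversed; asymmetry of `P` ensures
-- that no edge is charged twice.
oriented-edges≤edgeCount : ∀ {n} (G : Graph n) (P : Fin n → Fin n → Bool) →
  (∀ i k → P i k ≡ true → adj G i k ≡ true) → (∀ i k → P i k ≡ true → P k i ≡ false) →
  ∑ (allFin n) (λ i → ∑ (allFin n) (λ k → ⟦ P i k ⟧)) ≤ edgeCount G
oriented-edges≤edgeCount {n} G P P⇒adj asym = begin
  ∑∑ (λ i k → ⟦ P i k ⟧)
    ≤⟨ ∑-mono (allFin n) (λ i → ∑-mono (allFin n) (λ k → trichotomy i k)) ⟩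
  ∑∑ (λ i k → ⟦ (toℕ i <ᵇ toℕ k) ∧ P i k ⟧ + ⟦ (toℕ k <ᵇ toℕ i) ∧ P i k ⟧)
    ≡⟨ ∑∑-+ _ _ ⟩
  ∑∑ (λ i k → ⟦ (toℕ i <ᵇ toℕ k) ∧ P i k ⟧) + ∑∑ (λ i k → ⟦ (toℕ k <ᵇ toℕ i) ∧ P i k ⟧)
    ≡⟨ cong (∑∑ (λ i k → ⟦ (toℕ i <ᵇ toℕ k) ∧ P i k ⟧) +_) (∑-swap (allFin n) (allFin n) (λ i k → ⟦ (toℕ k <ᵇ toℕ i) ∧ P i k ⟧)) ⟩
  ∑∑ (λ i k → ⟦ (toℕ i <ᵇ toℕ k) ∧ P i k ⟧) + ∑∑ (λ i k → ⟦ (toℕ i <ᵇ toℕ k) ∧ P k i ⟧)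
    ≡⟨ ∑∑-+ _ _ ⟨
  ∑∑ (λ i k → ⟦ (toℕ i <ᵇ toℕ k) ∧ P i k ⟧ + ⟦ (toℕ i <ᵇ toℕ k) ∧ P k i ⟧)
    ≤⟨ ∑-mono (allFin n) (λ i → ∑-mono (allFin n) (λ k → one-edge i k (toℕ i <ᵇ toℕ k))) ⟩
  ∑∑ (λ i k → ⟦ (toℕ i <ᵇ toℕ k) ∧ adj G i k ⟧)
    ≡⟨ edgeCount≡∑ G ⟨
  edgeCount G ∎
  where
  open ≤-Reasoning
  ∑∑ : (Fin n → Fin n → ℕ) → ℕ
  ∑∑ w = ∑ (allFin n) (λ i → ∑ (allFin n) (w i))
  ∑∑-+ : ∀ v w → ∑∑ (λ i k → v i k + w i k) ≡ ∑∑ v + ∑∑ w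
  ∑∑-+ v w = trans (∑-cong (allFin n) (λ i → ∑-+ (allFin n) (v i) (w i))) (∑-+ (allFin n) _ _)
  P-irrefl : ∀ i → P i i ≡ false
  P-irrefl i with P i i in eq
  ... | false = refl
  ... | true  = trans (sym eq) (asym i i eq)
  T⇒≡ : ∀ {b} → T b → b ≡ true
  T⇒≡ {true} _ = refl
  trichotomy : ∀ i k → ⟦ P i k ⟧ ≤ ⟦ (toℕ i <ᵇ toℕ k) ∧ P i k ⟧ + ⟦ (toℕ k <ᵇ toℕ i) ∧ P i k ⟧
  trichotomy i k with <-cmp (toℕ i) (toℕ k)
  ... | tri< i<k _ _ rewrite T⇒≡ (<⇒<ᵇ i<k) = m≤m+n _ _
  ... | tri> _ _ k<i rewrite T⇒≡ (<⇒<ᵇ k<i) = m≤n+m _ _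
  ... | tri≈ _ i≡k _ rewrite Fin.toℕ-injective i≡k | P-irrefl k = z≤n
  one-edge : ∀ i k b → ⟦ b ∧ P i k ⟧ + ⟦ b ∧ P k i ⟧ ≤ ⟦ b ∧ adj G i k ⟧
  one-edge i k false = z≤n
  one-edge i k true with P i k in p | P k i in p′
  ... | false | false = z≤n
  ... | true  | false rewrite P⇒adj i k p = s≤s z≤n
  ... | false | true  rewrite trans (Graph.sym G i k) (P⇒adj k i p′) = s≤s z≤n
  ... | true  | true  = contradiction (trans (sym p′) (asym i k p)) λ ()

-- The loss (1 − 1/μ)^l ≥ 1 − 1/(m+1) for μ = l (m + 1), with T the size of a cube and V ≈ T/2.
half-power : ∀ l m T V .{{_ : NonZero l}} → l * suc m * T ≤ l * suc m * (2 * V) + T →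
             suc m * T ^ l ≤ suc m * (2 ^ l * V ^ l) + T ^ l
half-power l@(suc l′) m T V le = *-cancelˡ-≤ (l * μ ^ l) {{m*n≢0 l (μ ^ l) {{_}} {{m^n≢0 μ l}}}} (begin
  l * μ ^ l * (suc m * T ^ l)                               ≡⟨ e₁ l (μ ^ l) (suc m) (T ^ l) ⟩
  μ ^ l * μ * T ^ l                                         ≤⟨ *-monoˡ-≤ (T ^ l) bern ⟩
  (μ′ ^ l * μ + l * μ ^ l) * T ^ l                          ≡⟨ *-distribʳ-+ (T ^ l) (μ′ ^ l * μ) (l * μ ^ l) ⟩
  μ′ ^ l * μ * T ^ l + l * μ ^ l * T ^ l                    ≡⟨ cong (_+ l * μ ^ l * T ^ l) (trans (e₂ (μ′ ^ l) μ (T ^ l)) (cong (μ *_) (sym (^-distribʳ-* μ′ T l)))) ⟩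
  μ * (μ′ * T) ^ l + l * μ ^ l * T ^ l                      ≤⟨ +-monoˡ-≤ (l * μ ^ l * T ^ l) (*-monoʳ-≤ μ (^-monoˡ-≤ l smaller)) ⟩
  μ * (μ * (2 * V)) ^ l + l * μ ^ l * T ^ l                 ≡⟨ cong (λ x → μ * x + l * μ ^ l * T ^ l) (trans (^-distribʳ-* μ (2 * V) l) (cong (μ ^ l *_) (^-distribʳ-* 2 V l))) ⟩
  μ * (μ ^ l * (2 ^ l * V ^ l)) + l * μ ^ l * T ^ l         ≡⟨ e₃ l (suc m) (μ ^ l) (2 ^ l * V ^ l) (T ^ l) ⟩
  l * μ ^ l * (suc m * (2 ^ l * V ^ l) + T ^ l)             ∎)
  where
  open ≤-Reasoning
  μ = l * suc m
  μ′ = m + l′ * suc m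
  e₁ : ∀ l p m T → l * p * (m * T) ≡ p * (l * m) * T
  e₁ = solve-∀
  e₂ : ∀ p μ T → p * μ * T ≡ μ * (p * T)
  e₂ = solve-∀
  e₃ : ∀ l m p v T → l * m * (p * v) + l * p * T ≡ l * p * (m * v + T)
  e₃ = solve-∀
  bern : μ ^ l * μ ≤ μ′ ^ l * μ + l * μ ^ l
  bern = subst (λ x → x ^ l * x ≤ μ′ ^ l * x + l * x ^ l) (+-comm μ′ 1)
    (subst (λ x → (μ′ + 1) ^ l * (μ′ + 1) ≤ μ′ ^ l * (μ′ + 1) + x * (μ′ + 1) ^ l) (*-identityʳ l) (bernoulli μ′ 1 l))
  smaller : μ′ * T ≤ μ * (2 * V)
  smaller = +-cancelʳ-≤ T (μ′ * T) (μ * (2 * V)) (subst (_≤ μ * (2 * V) + T) (+-comm T (μ′ * T)) le)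

-- For `ν′ = 2tw`, the assumed number of edges is `(ν′²/4)(V/T)^l`, and `half-power` gives
-- `(2V/T)^l ≥ 1 − 1/(m + 1)`. The `ρ` leftover vertices cost `2ρν ≤ ν²/(m + 1)` more. The two
-- losses, `2ν²` after clearing, fit into the allowed `2^(l + 2) ν²`.
edge-density : ∀ l m T V c t ρ {ν e} .{{_ : NonZero l}} → l * suc m * T ≤ l * suc m * (2 * V) + T →
  let w = T ^ l * c in t * (t * (w * (c * V ^ l))) ≤ e → ν ≡ ρ + t * (w + w) → 2 * suc m * ρ ≤ ν →
  suc m * (ν * ν) ≤ 2 ^ (l + 2) * suc m * e + 2 ^ (l + 2) * (ν * ν)
edge-density l m T V c t ρ {ν} {e} le e≥ ν≡ small = begin
  suc m * (ν * ν)
    ≡⟨ cong (λ x → suc m * (x * x)) ν≡ ⟩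
  suc m * ((ρ + ν′) * (ρ + ν′))
    ≤⟨ m≤m+n _ (suc m * (ρ * ρ)) ⟩
  suc m * ((ρ + ν′) * (ρ + ν′)) + suc m * (ρ * ρ)
    ≡⟨ e₁ (suc m) ρ ν′ ⟩
  suc m * (ν′ * ν′) + 2 * suc m * ρ * (ρ + ν′)
    ≤⟨ +-mono-≤ main (subst (λ x → 2 * suc m * ρ * x ≤ ν * ν) ν≡ (*-monoˡ-≤ ν small)) ⟩
  L * suc m * e + ν′ * ν′ + ν * ν
    ≡⟨ +-assoc (L * suc m * e) (ν′ * ν′) (ν * ν) ⟩
  L * suc m * e + (ν′ * ν′ + ν * ν)
    ≤⟨ +-monoʳ-≤ (L * suc m * e) (+-monoˡ-≤ (ν * ν) (*-mono-≤ ν′≤ν ν′≤ν)) ⟩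
  L * suc m * e + (ν * ν + ν * ν)
    ≡⟨ cong (λ x → L * suc m * e + (ν * ν + x)) (sym (+-identityʳ (ν * ν))) ⟩
  L * suc m * e + 2 * (ν * ν)
    ≤⟨ +-monoʳ-≤ (L * suc m * e) (*-monoˡ-≤ (ν * ν) 2≤L) ⟩
  L * suc m * e + L * (ν * ν) ∎
  where
  open ≤-Reasoning
  L = 2 ^ (l + 2)
  w = T ^ l * c
  ν′ = t * (w + w)
  ν′≤ν : ν′ ≤ ν
  ν′≤ν = subst (ν′ ≤_) (sym ν≡) (m≤n+m ν′ ρ)
  L≡ : L ≡ 2 ^ l * 4
  L≡ = ^-distribˡ-+-* 2 l 2
  2≤L : 2 ≤ L
  2≤L = subst (2 ≤_) (sym L≡) (*-mono-≤ {1} {2 ^ l} {2} {4} (m^n>0 2 l) (s≤s (s≤s z≤n)))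
  e₁ : ∀ m ρ n → m * ((ρ + n) * (ρ + n)) + m * (ρ * ρ) ≡ m * (n * n) + 2 * m * ρ * (ρ + n)
  e₁ = solve-∀
  main : suc m * (ν′ * ν′) ≤ L * suc m * e + ν′ * ν′
  main = begin
    suc m * (ν′ * ν′)
      ≡⟨ e₂ (suc m) t (T ^ l) c ⟩
    4 * (t * t * (w * c)) * (suc m * T ^ l)
      ≤⟨ *-monoʳ-≤ (4 * (t * t * (w * c))) (half-power l m T V le) ⟩
    4 * (t * t * (w * c)) * (suc m * (2 ^ l * V ^ l) + T ^ l)
      ≡⟨ e₃ t (T ^ l) c (suc m) (2 ^ l) (V ^ l) ⟩
    2 ^ l * 4 * suc m * (t * (t * (w * (c * V ^ l)))) + ν′ * ν′
      ≤⟨ +-monoˡ-≤ (ν′ * ν′) (*-mono-≤ (≤-reflexive (cong (_* suc m) (sym L≡))) e≥) ⟩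
    L * suc m * e + ν′ * ν′ ∎
    where
    e₂ : ∀ m t T c → m * (t * (T * c + T * c) * (t * (T * c + T * c))) ≡ 4 * (t * t * (T * c * c)) * (m * T)
    e₂ = solve-∀
    e₃ : ∀ t T c m p v → 4 * (t * t * (T * c * c)) * (m * (p * v) + T) ≡ p * 4 * m * (t * (t * (T * c * (c * v)))) + t * (T * c + T * c) * (t * (T * c + T * c))
    e₃ = solve-∀

-- The blown-up graph: edges, independence number and cliques

does-true⁻ : ∀ {P : Set} (p? : Dec P) → does p? ≡ true → P
does-true⁻ (yes p) _ = p

module BlowUp (r ℓ : ℕ) (σ : Fin r → Vec Bool ℓ) (z C a h : ℕ) .{{_ : NonZero z}} (E : Vec (Fin (z * z) × Fin (z * z)) (h + h)) where

  n τ : ℕ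
  n = z * z
  τ = 2 * (C * z)

  open Construction r ℓ σ n τ a h E public

  shades : List (Vec (Vec Bool (h + h)) ℓ)
  shades = words (cube (h + h)) ℓ

  types : List VertexType
  types = cartesianProduct shades (words symbols n)

  vertices : List Vertex
  vertices = map (true ,_) types ++ map (false ,_) types

  c : ℕ
  c = length symbols

  blank : Symbol
  blank = Vec.replicate ℓ false , Vec.replicate r false , fill r (Vec.replicate r false)

  v₀ : Vertex
  v₀ = true , Vec.replicate ℓ (Vec.replicate (h + h) false) , Vec.replicate n blank

  c>0 : 0 < c
  c>0 = ∈⇒0<length (symbols-complete blank)

  length-types : length types ≡ (2 ^ (h + h)) ^ ℓ * c ^ n
  length-types = trans (length-cartesianProduct shades (words symbols n))
    (cong₂ _*_ (trans (length-words (cube (h + h)) ℓ) (cong (_^ ℓ) (length-words bits (h + h)))) (length-words symbols n))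

  types>0 : 0 < length types
  types>0 = subst (0 <_) (sym length-types)
    (>-nonZero⁻¹ _ {{m*n≢0 _ _ {{m^n≢0 (2 ^ (h + h)) ℓ {{m^n≢0 2 (h + h)}}}} {{m^n≢0 c n {{>-nonZero c>0}}}}}})

  ∑-types : ∀ g → ∑ types g ≡ ∑ shades (λ u → ∑ (words symbols n) (λ γ → g (u , γ)))
  ∑-types g = ∑-cartesianProductWith _,_ shades (words symbols n) g

  ∑-vertices : ∀ g → ∑ vertices g ≡ ∑ types (λ x → g (true , x)) + ∑ types (λ x → g (false , x))
  ∑-vertices g = trans (∑-++ (map (true ,_) types) (map (false ,_) types) g)
    (cong₂ _+_ (∑-map (true ,_) types g) (∑-map (false ,_) types g))

  length-vertices : length vertices ≡ length types + length types
  length-vertices = trans (sym (∑-length vertices)) (trans (∑-vertices (λ _ → 1)) (cong₂ _+_ (∑-length types) (∑-length types)))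

  -- The preimages of `𝒜` under the `r` roles are all as dense as `𝒜`, so some `x` is within `Cz` of
  -- each of them. Two words near `x` are within `2Cz` of each other, the origin of `τ`.
  linked-family : ∀ e (𝒜 : Word → Bool) → r * (2 * e) < 2 ^ C → c ^ n ≤ e * ∑ (words symbols n) (⟦_⟧ ∘ 𝒜) →
    ∃ λ (γ : Fin r → Word) → (∀ j → 𝒜 (γ j) ≡ true) × (∀ j j′ → j ≢ j′ → Linked (γ j) (γ j′) j j′)
  linked-family e 𝒜 r2e<2^C dense = family
    (common-neighbour e (λ j → 𝒜 ∘ Vec.map (act j)) c>0 r2e<2^C
      (λ j → subst (λ s → c ^ n ≤ e * s) (sym (∑-words-map (∑-act j) n (⟦_⟧ ∘ 𝒜))) dense))
    where
    open Concentration _≟ˢ_ symbols symbols-complete z C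
    strip-act : ∀ j (x : Word) → strip j (Vec.map (act j) x) ≡ x
    strip-act j x = trans (sym (Vec.map-∘ (unact j) (act j) x)) (trans (Vec.map-cong (unact-act j) x) (Vec.map-id x))
    family : (∃ λ x → ∀ j → ∃ λ w → 𝒜 (Vec.map (act j) w) ≡ true × hamming w x ≤ C * z) →
      ∃ λ (γ : Fin r → Word) → (∀ j → 𝒜 (γ j) ≡ true) × (∀ j j′ → j ≢ j′ → Linked (γ j) (γ j′) j j′)
    family (x , near) = (λ j → Vec.map (act j) (w j)) , (λ j → proj₁ (proj₂ (near j))) , λ j j′ j≢j′ → j≢j′ , (begin
      hamming (strip j (Vec.map (act j) (w j))) (strip j′ (Vec.map (act j′) (w j′)))
        ≡⟨ cong₂ hamming (strip-act j (w j)) (strip-act j′ (w j′)) ⟩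
      hamming (w j) (w j′)
        ≤⟨ hamming-triangle (w j) x (w j′) ⟩
      hamming (w j) x + hamming x (w j′)
        ≤⟨ +-mono-≤ (proj₂ (proj₂ (near j))) (≤-trans (≤-reflexive (hamming-sym x (w j′))) (proj₂ (proj₂ (near j′)))) ⟩
      C * z + C * z
        ≡⟨ cong (C * z +_) (sym (+-identityʳ (C * z))) ⟩
      τ ∎)
      where
      open ≤-Reasoning
      w : Fin r → Word
      w j = proj₁ (near j)

  module OnVertices {ν : ℕ} (f : Fin ν → Vertex) (τ<n : τ < n) where

    graph : Graph ν
    graph = record
      { adj    = λ i k → does (Adj? (f i) (f k))
      ; sym    = λ i k → does-⇔ (mk⇔ (Adj-sym (f i) (f k)) (Adj-sym (f k) (f i))) (Adj? (f i) (f k)) (Adj? (f k) (f i))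
      ; irrefl = λ i → dec-false (Adj? (f i) (f i)) (Adj-irrefl τ<n (f i))
      }

    adj⇒Adj : ∀ i k → adj graph i k ≡ true → Adj (f i) (f k)
    adj⇒Adj i k = does-true⁻ (Adj? (f i) (f k))

    module Spread (t ρ : ℕ) (spread : ∀ g → ∑ (allFin ν) (g ∘ f) ≡ t * ∑ vertices g + ρ * g v₀)
      (ν≡ : ν ≡ ρ + t * (length types + length types)) where

      -- For each fixed `γ′`, summing over the shades gives `lights a h ^ ℓ`, so all types see
      -- equally many types across. Edges inside the halves and those due to the `ρ` extra copies
      -- are dropped.
      cross-edges : t * (t * (length types * (c ^ n * lights a h ^ ℓ))) ≤ edgeCount graph
      cross-edges = begin
        t * (t * (length types * (c ^ n * lights a h ^ ℓ)))
          ≡⟨ cong (λ s → t * (t * s)) pairs ⟩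
        t * (t * ∑ types (λ x → ∑ types (λ y → ⟦ cross x y ⟧)))
          ≤⟨ *-monoʳ-≤ t (*-monoʳ-≤ t (∑-mono types (λ x → right x))) ⟩
        t * (t * ∑ types (λ x → ∑ vertices (λ w → ⟦ crossing (true , x) w ⟧)))
          ≤⟨ *-monoʳ-≤ t (*-monoʳ-≤ t (≤-trans (m≤m+n _ _) (≤-reflexive (sym (∑-vertices (λ v → ∑ vertices (λ w → ⟦ crossing v w ⟧))))))) ⟩
        t * (t * ∑ vertices (λ v → ∑ vertices (λ w → ⟦ crossing v w ⟧)))
          ≡⟨ cong (t *_) (∑-*ˡ vertices t _) ⟨
        t * ∑ vertices (λ v → t * ∑ vertices (λ w → ⟦ crossing v w ⟧))
          ≤⟨ *-monoʳ-≤ t (∑-mono vertices (λ v → spread≤ (λ w → ⟦ crossing v w ⟧))) ⟩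
        t * ∑ vertices (λ v → ∑ (allFin ν) (λ k → ⟦ crossing v (f k) ⟧))
          ≤⟨ spread≤ (λ v → ∑ (allFin ν) (λ k → ⟦ crossing v (f k) ⟧)) ⟩
        ∑ (allFin ν) (λ i → ∑ (allFin ν) (λ k → ⟦ crossing (f i) (f k) ⟧))
          ≤⟨ oriented-edges≤edgeCount graph (λ i k → crossing (f i) (f k))
               (λ i k eq → dec-true (Adj? (f i) (f k)) (crossing⇒Adj (f i) (f k) eq)) (λ i k → crossing-asym (f i) (f k)) ⟩
        edgeCount graph ∎
        where
        open ≤-Reasoning
        spread≤ : ∀ g → t * ∑ vertices g ≤ ∑ (allFin ν) (g ∘ f)
        spread≤ g = ≤-trans (m≤m+n _ _) (≤-reflexive (sym (spread g)))
        crossing : Vertex → Vertex → Bool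
        crossing (true  , x) (false , y) = cross x y
        crossing (true  , x) (true  , y) = false
        crossing (false , x) w           = false
        crossing⇒Adj : ∀ v w → crossing v w ≡ true → Adj v w
        crossing⇒Adj (true , x) (false , y) eq = eq
        crossing-asym : ∀ v w → crossing v w ≡ true → crossing w v ≡ false
        crossing-asym (true , x) (false , y) _ = refl
        right : ∀ x → ∑ types (λ y → ⟦ cross x y ⟧) ≤ ∑ vertices (λ w → ⟦ crossing (true , x) w ⟧)
        right x = ≤-trans (m≤n+m _ _) (≤-reflexive (sym (∑-vertices (λ w → ⟦ crossing (true , x) w ⟧))))
        pairs : length types * (c ^ n * lights a h ^ ℓ) ≡ ∑ types (λ x → ∑ types (λ y → ⟦ cross x y ⟧))
        pairs = sym (trans (∑-cong types neighbours) (∑-const types _))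
          where
          neighbours : ∀ x → ∑ types (λ y → ⟦ cross x y ⟧) ≡ c ^ n * lights a h ^ ℓ
          neighbours (u , γ) = trans (∑-types (λ y → ⟦ cross (u , γ) y ⟧))
            (trans (∑-swap shades (words symbols n) (λ u′ γ′ → ⟦ cross (u , γ) (u′ , γ′) ⟧))
            (trans (∑-cong (words symbols n) (λ γ′ → ∑-allLight (comparison γ γ′)))
            (trans (∑-const (words symbols n) _) (cong (_* lights a h ^ ℓ) (length-words symbols n)))))

      module _ (k : ℕ) (r2e<2^C : r * (2 * (2 * suc k)) < 2 ^ C) (eρ≤ν : 2 * suc k * ρ ≤ ν) (S : Subset ν) where

        private
          -- The allowed fraction `1/(k + 1)` is split evenly between the `t` full copies and the
          -- `ρ` leftover vertices.
          e = 2 * suc k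

          occupied? : ∀ v → Dec (∃ λ i → lookup S i ≡ true × f i ≡ v)
          occupied? v = Fin.any? (λ i → (lookup S i Bool.≟ true) ×-dec (f i ≟ᵛ v))
            where
            _≟ᵛ_ : DecidableEquality Vertex
            _≟ᵛ_ = Product.≡-dec Bool._≟_ (Product.≡-dec (Vec.≡-dec (Vec.≡-dec Bool._≟_)) (Vec.≡-dec _≟ˢ_))

          -- One copy in `S` suffices: it bounds `S` by `t` per occupied vertex, and a clique needs
          -- only one copy of each vertex.
          occupied : Vertex → Bool
          occupied v = does (occupied? v)

          occupancy : Bool → ℕ
          occupancy s = ∑ types (λ x → ⟦ occupied (s , x) ⟧)

          size≤ : ∣ S ∣ ≤ t * (occupancy true + occupancy false) + ρ
          size≤ = begin
            ∣ S ∣                                                    ≡⟨ ∣∣≡∑ S ⟩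
            ∑ (allFin ν) (λ i → ⟦ lookup S i ⟧)                      ≤⟨ ∑-mono (allFin ν) pointwise ⟩
            ∑ (allFin ν) (λ i → ⟦ occupied (f i) ⟧)                  ≡⟨ spread (⟦_⟧ ∘ occupied) ⟩
            t * ∑ vertices (⟦_⟧ ∘ occupied) + ρ * ⟦ occupied v₀ ⟧    ≤⟨ +-mono-≤ (≤-reflexive (cong (t *_) (∑-vertices (⟦_⟧ ∘ occupied))))
                                                                           (≤-trans (*-monoʳ-≤ ρ (⟦⟧≤1 (occupied v₀))) (≤-reflexive (*-identityʳ ρ))) ⟩
            t * (occupancy true + occupancy false) + ρ               ∎
            where
            open ≤-Reasoning
            pointwise : ∀ i → ⟦ lookup S i ⟧ ≤ ⟦ occupied (f i) ⟧
            pointwise i with lookup S i in Si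
            ... | false = z≤n
            ... | true  rewrite dec-true (occupied? (f i)) (i , Si , refl) = ≤-refl

          small : e * occupancy true ≤ length types → e * occupancy false ≤ length types → ∣ S ∣ * suc k ≤ ν
          small le le′ = *-cancelˡ-≤ 2 (begin
            2 * (∣ S ∣ * suc k)
              ≡⟨ e₁ ∣ S ∣ k ⟩
            e * ∣ S ∣
              ≤⟨ *-monoʳ-≤ e size≤ ⟩
            e * (t * (occupancy true + occupancy false) + ρ)
              ≡⟨ e₂ e t (occupancy true) (occupancy false) ρ ⟩
            t * (e * occupancy true + e * occupancy false) + e * ρ
              ≤⟨ +-mono-≤ (*-monoʳ-≤ t (+-mono-≤ le le′)) eρ≤ν ⟩
            t * (length types + length types) + ν
              ≤⟨ +-monoˡ-≤ ν (≤-trans (m≤n+m _ ρ) (≤-reflexive (sym ν≡))) ⟩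
            ν + ν
              ≡⟨ cong (ν +_) (sym (+-identityʳ ν)) ⟩
            2 * ν ∎)
            where
            open ≤-Reasoning
            e₁ : ∀ s k → 2 * (s * (1 + k)) ≡ 2 * (1 + k) * s
            e₁ = solve-∀
            e₂ : ∀ e t x y ρ → e * (t * (x + y) + ρ) ≡ t * (e * x + e * y) + e * ρ
            e₂ = solve-∀

          same-shade : ∀ s u {γ γ′ j j′} → Linked γ γ′ j j′ → Adj (s , u , γ) (s , u , γ′)
          same-shade true  u l = refl , _ , _ , l
          same-shade false u l = refl , _ , _ , l

          -- Joined types on one side share their shade, so the clique is sought within one shade
          -- `u`, which averaging finds with a dense set of occupied words.
          large : ∀ s → length types < e * occupancy s → HasCliqueIn r graph S
          large s lt = clique (∑-<⇒∃ shades (begin-strict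
            ∑ shades (λ _ → c ^ n)
              ≡⟨ ∑-const shades (c ^ n) ⟩
            length shades * c ^ n
              ≡⟨ cong (length shades *_) (length-words symbols n) ⟨
            length shades * length (words symbols n)
              ≡⟨ length-cartesianProduct shades (words symbols n) ⟨
            length types
              <⟨ lt ⟩
            e * occupancy s
              ≡⟨ cong (e *_) (∑-types (λ x → ⟦ occupied (s , x) ⟧)) ⟩
            e * ∑ shades (λ u → ∑ (words symbols n) (λ γ → ⟦ occupied (s , u , γ) ⟧))
              ≡⟨ ∑-*ˡ shades e _ ⟨
            ∑ shades (λ u → e * ∑ (words symbols n) (λ γ → ⟦ occupied (s , u , γ) ⟧)) ∎))
            where
            open ≤-Reasoning
            clique : (∃ λ u → c ^ n < e * ∑ (words symbols n) (λ γ → ⟦ occupied (s , u , γ) ⟧)) → HasCliqueIn r graph S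
            clique (u , dense) = place (linked-family e (λ γ → occupied (s , u , γ)) r2e<2^C (<⇒≤ dense))
              where
              place : (∃ λ (γ : Fin r → Word) → (∀ j → occupied (s , u , γ j) ≡ true) × (∀ j j′ → j ≢ j′ → Linked (γ j) (γ j′) j j′)) →
                      HasCliqueIn r graph S
              place (γ , occ , link) = pick , injective , (λ j → Vec.lookup⇒[]= (pick j) S (proj₁ (proj₂ (position j)))) , adjacent
                where
                position : ∀ j → ∃ λ i → lookup S i ≡ true × f i ≡ (s , u , γ j)
                position j = does-true⁻ (occupied? (s , u , γ j)) (occ j)
                pick : Fin r → Fin ν
                pick j = proj₁ (position j)
                adjacent′ : ∀ j j′ → j ≢ j′ → Adj (f (pick j)) (f (pick j′))
                adjacent′ j j′ j≢j′ = subst (λ v → Adj v (f (pick j′))) (sym (proj₂ (proj₂ (position j))))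
                  (subst (Adj (s , u , γ j)) (sym (proj₂ (proj₂ (position j′)))) (same-shade s u (link j j′ j≢j′)))
                adjacent : ∀ j j′ → j ≢ j′ → adj graph (pick j) (pick j′) ≡ true
                adjacent j j′ j≢j′ = dec-true (Adj? (f (pick j)) (f (pick j′))) (adjacent′ j j′ j≢j′)
                injective : ∀ {j j′} → pick j ≡ pick j′ → j ≡ j′
                injective {j} {j′} eq with j Fin.≟ j′
                ... | yes j≡j′ = j≡j′
                ... | no  j≢j′ = contradiction (subst (λ i → Adj (f (pick j)) (f i)) (sym eq) (adjacent′ j j′ j≢j′)) (Adj-irrefl τ<n (f (pick j)))

        alpha-bound : ¬ HasCliqueIn r graph S → ∣ S ∣ * suc k ≤ ν
        alpha-bound none with e * occupancy true ≤? length types | e * occupancy false ≤? length types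
        ... | yes le | yes le′ = small le le′
        ... | no  gt | _       = contradiction (large true (≰⇒> gt)) none
        ... | yes _  | no gt   = contradiction (large false (≰⇒> gt)) none

  clique-free : ∀ {ν} (f : Fin ν → Vertex) (τ<n : τ < n) →
    (∀ (p p′ : Fin n → Bool) → ∑ (allFin n) (⟦_⟧ ∘ p) ≤ τ → ∑ (allFin n) (⟦_⟧ ∘ p′) ≤ τ →
      ∑ (allFin (h + h)) (λ k → ⟦ p (proj₁ (lookup E k)) ∧ p′ (proj₂ (lookup E k)) ⟧) ≤ a) →
    ∀ {q} (quot : Fin r → Fin q) → (∀ {j k} → σ j ≡ σ k → quot j ≡ quot k → j ≡ k) → Fin r →
    ∀ R → r + q < R → R * (R * τ) < n → CliqueFree R (OnVertices.graph f τ<n)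
  clique-free f τ<n sparse quot inj j₀ R r+q<R room (g , _ , adjacent) = <⇒≱ r+q<R
    (Clique.clique-bound sparse quot inj j₀ (f ∘ g) (λ i k i≢k → OnVertices.adj⇒Adj f τ<n (g i) (g k) (adjacent i k i≢k)) room)

-- Any injection of Fin r into Fin (q 2^l) splits each role into a colour and a remainder below q.
colouring : ∀ r q l → r ≤ q * 2 ^ l → ∃₂ λ (σ : Fin r → Vec Bool l) (quot : Fin r → Fin q) →
            ∀ {j k} → σ j ≡ σ k → quot j ≡ quot k → j ≡ k
colouring r q l r≤ = σ , quot , injective
  where
  split : Fin r → Fin q × Fin (2 ^ l)
  split j = remQuot {q} (2 ^ l) (inject≤ j r≤)
  quot : Fin r → Fin q
  quot j = proj₁ (split j)
  digit : Fin 2 → Bool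
  digit zero    = false
  digit (suc _) = true
  digit-injective : ∀ {x y} → digit x ≡ digit y → x ≡ y
  digit-injective {zero}     {zero}     _ = refl
  digit-injective {suc zero} {suc zero} _ = refl
  σ : Fin r → Vec Bool l
  σ j = Vec.tabulate (digit ∘ finToFun (proj₂ (split j)))
  funToFin-cong : ∀ {n} {f g : Fin n → Fin 2} → (∀ i → f i ≡ g i) → funToFin f ≡ funToFin g
  funToFin-cong {zero}  _   = refl
  funToFin-cong {suc n} f≗g = cong₂ combine (f≗g zero) (funToFin-cong (f≗g ∘ suc))
  colour≡ : ∀ {j k} → σ j ≡ σ k → proj₂ (split j) ≡ proj₂ (split k)
  colour≡ {j} {k} eq = trans (sym (Fin.funToFin-finToFin {l} {2} (proj₂ (split j))))
    (trans (funToFin-cong (λ b → digit-injective (trans (sym (Vec.lookup∘tabulate _ b)) (trans (cong (λ x → lookup x b) eq) (Vec.lookup∘tabulate _ b)))))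
           (Fin.funToFin-finToFin {l} {2} (proj₂ (split k))))
  injective : ∀ {j k} → σ j ≡ σ k → quot j ≡ quot k → j ≡ k
  injective {j} {k} σ≡ quot≡ = Fin.inject≤-injective r≤ r≤ j k
    (trans (sym (Fin.combine-remQuot {q} (2 ^ l) (inject≤ j r≤)))
      (trans (cong₂ combine quot≡ (colour≡ σ≡)) (Fin.combine-remQuot {q} (2 ^ l) (inject≤ k r≤))))

-- Assembly and choice of parameters

≤ceilDivPow2* : ∀ r l → r ≤ ceilDivPow2 r l * 2 ^ l
≤ceilDivPow2* r l = +-cancelˡ-≤ p r _ (begin
  p + r                                          ≡⟨ +-comm p r ⟩
  r + p                                          ≡⟨ m≡m%n+[m/n]*n (r + p) (2 ^ l) ⟩
  (r + p) % 2 ^ l + (r + p) / 2 ^ l * 2 ^ l      ≤⟨ +-monoˡ-≤ ((r + p) / 2 ^ l * 2 ^ l) (<⇒≤pred (m%n<n (r + p) (2 ^ l))) ⟩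
  p + (r + p) / 2 ^ l * 2 ^ l                    ∎)
  where
  open ≤-Reasoning
  p = 2 ^ l ∸ 1
  instance
    2^l≢0 : NonZero (2 ^ l)
    2^l≢0 = m^n≢0 2 l

module Family (r s l q : ℕ) .{{_ : NonZero l}} (σ : Fin r → Vec Bool l) (quot : Fin r → Fin q)
  (injective : ∀ {j k} → σ j ≡ σ k → quot j ≡ quot k → j ≡ k) (j₀ : Fin r) (q<s : q < s) (k m : ℕ) where

  Goal : Set
  Goal = ∃[ N ] ∀ (n : ℕ) → N ≤ n →
    Σ (Graph n) λ G →
      CliqueFree (r + s) G × AlphaAtMostFrac r G k ×
      (suc m * (n * n) ≤ 2 ^ (l + 2) * suc m * edgeCount G + 2 ^ (l + 2) * (n * n))

  assemble : ∀ (z C a h : ℕ) .{{_ : NonZero z}} (E : Vec (Fin (z * z) × Fin (z * z)) (h + h)) →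
    (∀ (p p′ : Fin (z * z) → Bool) → ∑ (allFin (z * z)) (⟦_⟧ ∘ p) ≤ 2 * (C * z) → ∑ (allFin (z * z)) (⟦_⟧ ∘ p′) ≤ 2 * (C * z) →
      ∑ (allFin (h + h)) (λ k → ⟦ p (proj₁ (lookup E k)) ∧ p′ (proj₂ (lookup E k)) ⟧) ≤ a) →
    r * (2 * (2 * suc k)) < 2 ^ C →
    l * suc m * 2 ^ (h + h) ≤ l * suc m * (2 * lights a h) + 2 ^ (h + h) →
    (r + s) * ((r + s) * (2 * (C * z))) < z * z → 0 < r + s →
    Goal
  -- The remainder `ρ < W` must be negligible both for the independence number, against `2(k + 1)`,
  -- and for the edges, against `2(m + 1)`; the threshold adds the two demands.
  assemble z C a h E sparse r2e<2^C balanced room r+s>0 = (2 * suc k + 2 * suc m) * W , build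
    where
    open BlowUp r l σ z C a h E
    W : ℕ
    W = length vertices
    instance
      W≢0 : NonZero W
      W≢0 = >-nonZero (subst (0 <_) (sym length-vertices) (≤-trans types>0 (m≤m+n _ _)))
      r+s≢0 : NonZero (r + s)
      r+s≢0 = >-nonZero r+s>0
    τ<n : τ < n
    τ<n = ≤-<-trans (≤-trans (m≤n*m τ (r + s)) (m≤n*m ((r + s) * τ) (r + s))) room
    build : ∀ ν → (2 * suc k + 2 * suc m) * W ≤ ν → Σ (Graph ν) λ G →
      CliqueFree (r + s) G × AlphaAtMostFrac r G k ×
      (suc m * (ν * ν) ≤ 2 ^ (l + 2) * suc m * edgeCount G + 2 ^ (l + 2) * (ν * ν))
    build ν big = conclude (blow-up-map vertices v₀ t ρ (m≡m%n+[m/n]*n ν W))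
      where
      t ρ : ℕ
      t = ν / W
      ρ = ν % W
      ρ-small : ∀ x → x ≤ 2 * suc k + 2 * suc m → x * ρ ≤ ν
      ρ-small x x≤ = ≤-trans (*-mono-≤ x≤ (<⇒≤ (m%n<n ν W))) big
      ν≡ : ν ≡ ρ + t * (length types + length types)
      ν≡ = trans (m≡m%n+[m/n]*n ν W) (cong (λ w → ρ + t * w) length-vertices)
      conclude : (∃ λ (f : Fin ν → Vertex) → ∀ g → ∑ (allFin ν) (g ∘ f) ≡ t * ∑ vertices g + ρ * g v₀) → Σ (Graph ν) λ G →
        CliqueFree (r + s) G × AlphaAtMostFrac r G k ×
        (suc m * (ν * ν) ≤ 2 ^ (l + 2) * suc m * edgeCount G + 2 ^ (l + 2) * (ν * ν))
      conclude (f , spread) = graph ,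
        clique-free f τ<n sparse quot injective j₀ (r + s) (+-monoʳ-< r q<s) room ,
        alpha-bound k r2e<2^C (ρ-small (2 * suc k) (m≤m+n _ _)) ,
        edge-density l m (2 ^ (h + h)) (lights a h) (c ^ n) t ρ balanced
          (subst (λ w → t * (t * (w * (c ^ n * lights a h ^ l))) ≤ edgeCount graph) length-types cross-edges)
          (subst (λ w → ν ≡ ρ + t * (w + w)) length-types ν≡) (ρ-small (2 * suc m) (m≤n+m _ (2 * suc k)))
        where
        open OnVertices f τ<n
        open Spread t ρ spread ν≡

  private
    R = r + s
    μ = l * suc m

  -- With 2h = (2Bz)², the deviation from h is of order Bz, and B = 2Aμ makes it large compared to
  -- a = Az, which is the number of edges that sets of 2Cz positions may span. The bound on y
  -- provides 2^m′ ≤ z^z and leaves room for a position without errors in any clique.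
  parameters : ∀ C K A B y .{{_ : NonZero K}} .{{_ : NonZero A}} .{{_ : NonZero y}} .{{_ : NonZero R}} →
    r * (2 * (2 * suc k)) < 2 ^ C → K ≡ 4 * (C * C) → A ≡ 8 * C + 1 → B ≡ 2 * A * μ →
    2 ^ (8 * (B * B) * K) + R * (R * (2 * C)) ≤ y → Goal
  parameters C K A B y r2e<2^C K≡ A≡ refl y≥ = from (Sparse.sparse-incidence C K y m′ (h + h) K≡ h+h≡ 2^m′≤)
    where
    open ≤-Reasoning
    z = 2 * K * y
    h = 2 * (B * B) * (z * z)
    m′ = 8 * (B * B) * K * z
    instance
      2K≢0 : NonZero (2 * K)
      2K≢0 = m*n≢0 2 K
      z≢0 : NonZero z
      z≢0 = m*n≢0 (2 * K) y
      μ≢0 : NonZero μ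
      μ≢0 = m*n≢0 l (suc m)
    y≤z : y ≤ z
    y≤z = m≤n*m y (2 * K)
    h+h≡ : h + h ≡ y * m′
    h+h≡ = e B K y
      where
      e : ∀ B K y → 2 * (B * B) * (2 * K * y * (2 * K * y)) + 2 * (B * B) * (2 * K * y * (2 * K * y)) ≡ y * (8 * (B * B) * K * (2 * K * y))
      e = solve-∀
    2^m′≤ : 2 ^ m′ ≤ z ^ z
    2^m′≤ = begin
      2 ^ (8 * (B * B) * K * z)      ≡⟨ ^-*-assoc 2 (8 * (B * B) * K) z ⟨
      (2 ^ (8 * (B * B) * K)) ^ z    ≤⟨ ^-monoˡ-≤ z (≤-trans (m≤m+n _ _) (≤-trans y≥ y≤z)) ⟩
      z ^ z                          ∎
    room : R * (R * (2 * (C * z))) < z * z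
    room = begin-strict
      R * (R * (2 * (C * z)))    ≡⟨ e R C z ⟩
      R * (R * (2 * C)) * z      <⟨ *-monoˡ-< z (<-≤-trans (m<n+m (R * (R * (2 * C))) (m^n>0 2 (8 * (B * B) * K))) (≤-trans y≥ y≤z)) ⟩
      z * z                      ∎
      where
      e : ∀ R C z → R * (R * (2 * (C * z))) ≡ R * (R * (2 * C)) * z
      e = solve-∀
    from : (∃ λ (E : Vec (Fin (z * z) × Fin (z * z)) (h + h)) → ∀ (p p′ : Fin (z * z) → Bool) →
             ∑ (allFin (z * z)) (⟦_⟧ ∘ p) ≤ 2 * (C * z) → ∑ (allFin (z * z)) (⟦_⟧ ∘ p′) ≤ 2 * (C * z) →
             ∑ (allFin (h + h)) (λ k → ⟦ p (proj₁ (lookup E k)) ∧ p′ (proj₂ (lookup E k)) ⟧) ≤ (8 * C + 1) * z) → Goal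
    from (E , sparse) = assemble z C (A * z) h E
      (λ p p′ few few′ → ≤-trans (sparse p p′ few few′) (≤-reflexive (cong (_* z) (sym A≡))))
      r2e<2^C (anticoncentration A μ z) room (>-nonZero⁻¹ R)

theorem2 : ∀ (r s l : ℕ) → 2 ≤ s → s ≤ r → IsLeastEll r s l →
    ∀ (k m : ℕ) → ∃[ N ] ∀ (n : ℕ) → N ≤ n →
    Σ (Graph n) λ G →
    CliqueFree (r + s) G × AlphaAtMostFrac r G k ×
    (suc m * (n * n) ≤ 2 ^ (l + 2) * suc m * edgeCount G + 2 ^ (l + 2) * (n * n))
theorem2 r@(suc _) s@(suc _) l@(suc _) _ _ (_ , q<s , _) k m with colouring r (ceilDivPow2 r l) l (≤ceilDivPow2* r l)
... | σ , quot , injective = parameters c (4 * (c * c)) (8 * c + 1) (2 * (8 * c + 1) * (l * suc m)) (2 ^ P + (r + s) * ((r + s) * (2 * c)))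
    {{m*n≢0 4 (c * c) {{_}} {{m*n≢0 c c}}}} {{>-nonZero (m≤n+m 1 (8 * c))}} {{>-nonZero (≤-trans (m^n>0 2 P) (m≤m+n _ _))}}
    (n<2^n c) refl refl refl ≤-refl
  where
  open Family r s l (ceilDivPow2 r l) σ quot injective zero q<s k m
  -- Concentration asks for `r(2e) < 2^C` with `e = 2(k + 1)`; the left side itself is a valid `C`,
  -- as `x < 2^x`.
  c = r * (2 * (2 * suc k))
  b = 2 * (8 * c + 1) * (l * suc m)
  P = 8 * (b * b) * (4 * (c * c))
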